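{- Let $t \ge 3$ be an integer and let $G$ be a connected graph that does not contain $K_t$ as an odd minor. Then there exist $\ell \in \mathbb{N}$ and pairwise vertex-disjoint connected induced subgraphs $H_1,\dots,H_\ell$ of $G$ with $V(H_1)\cup\cdots\cup V(H_\ell) = V(G)$ such that for every $i \in [\ell]$ the following hold: (1) $V(H_i)$ admits a partition into two disjoint sets $A_i, B_i$ such that every connected component of $G[A_i]$ and of $G[B_i]$ has at most $\lceil \frac{t-2}{2}\rceil$ vertices; (2) the spanning subgraph of $H_i$ whose edges are exactly the edges of $H_i$ with one endpoint in $A_i$ and the other in $B_i$ is connected; (3) every vertex $v \in V(G)\setminus (V(H_1)\cup\cdots\cup V(H_i))$ that is adjacent in $G$ to at least one vertex of $V(H_i)$ has a neighbor $a \in A_i$ and a neighbor $b\in B_i$; (4) for every connected component $C$ of $G - (V(H_1)\cup\cdots\cup V(H_i))$, at most $t-2$ of the subgraphs $H_1,\dots,H_i$ are adjacent to $G[C]$, and these subgraphs adjacent to $G[C]$ are pairwise adjacent to each other.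
   Context: All graphs are finite and simple; $[k]=\{1,\dots,k\}$. Two vertex-disjoint subgraphs $H, H'$ of $G$ are adjacent if some edge of $G$ has one endpoint in $V(H)$ and the other in $V(H')$. A connected component is regarded as a vertex set. For an integer $t\ge 1$, a $K_t$-expansion is a graph $F$ consisting of $t$ vertex-disjoint trees $T_1,\dots,T_t$ together with, for each pair of distinct trees, exactly one additional edge joining them. A $K_t$-expansion $F$ is odd if there is a $2$-coloring of $V(F)$ whose restriction to each tree $T_s$ is a proper coloring of $T_s$, while every edge joining two distinct trees has both endpoints of the same color. A graph $G$ contains $K_t$ as an odd minor if some subgraph of $G$ is an odd $K_t$-expansion. -}

module Defs where

open import Data.Bool using (Bool)
open import Data.Fin using (Fin; toℕ)
open import Data.Fin.Subset using (Subset; _∈_; _⊆_; _∩_; _─_; ⋃; ∣_∣; Nonempty; Empty)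
open import Data.Fin.Subset.Properties using (_∈?_; x∈p∩q⁺)
open import Data.List using (List; _∷_; _∷ʳ_; length; tabulate; take)
open import Data.List.Relation.Unary.Linked using (Linked)
open import Data.List.Relation.Unary.Unique.Propositional using (Unique)
open import Data.Nat using (ℕ; suc; _≤_)
open import Data.Product using (Σ-syntax; ∃-syntax; ∃!; _×_; _,_; swap)
open import Data.Sum using (_⊎_)
import Data.Sum as Sum
open import Function using (_∘_; _⇔_)
open import Relation.Binary using (Decidable; Symmetric)
open import Relation.Binary.Construct.Closure.ReflexiveTransitive using (Star)
open import Relation.Binary.PropositionalEquality using (_≡_; _≢_)
open import Relation.Nullary using (¬_; _×-dec_; _⊎-dec_)

private
  variable
    n : ℕ

-- A finite simple graph whose vertex set is a subset of the ambient set
-- Fin n, so that a graph and all of its subgraphs have the same type.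
record Graph (n : ℕ) : Set₁ where
  field
    V      : Subset n
    Adj    : Fin n → Fin n → Set
    adj?   : Decidable Adj
    sym    : Symmetric Adj
    irrefl : ∀ {u} → ¬ Adj u u
    inV    : ∀ {u v} → Adj u v → u ∈ V

open Graph public

Disjoint : Subset n → Subset n → Set
Disjoint p q = Empty (p ∩ q)

infix 4 _⊆ᴳ_ _⊆ⁱ_

_⊆ᴳ_ : Graph n → Graph n → Set
H ⊆ᴳ G = V H ⊆ V G × (∀ {u v} → Adj H u v → Adj G u v)

_⊆ⁱ_ : Graph n → Graph n → Set
H ⊆ⁱ G = H ⊆ᴳ G × (∀ {u v} → u ∈ V H → v ∈ V H → Adj G u v → Adj H u v)

infixl 8 _[_]
infixl 7 _-ᴳ_

_[_] : Graph n → Subset n → Graph n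
G [ S ] = record
  { V      = V G ∩ S
  ; Adj    = λ u v → Adj G u v × u ∈ S × v ∈ S
  ; adj?   = λ u v → adj? G u v ×-dec (u ∈? S) ×-dec (v ∈? S)
  ; sym    = λ (e , u∈S , v∈S) → sym G e , v∈S , u∈S
  ; irrefl = λ (e , _) → irrefl G e
  ; inV    = λ (e , u∈S , _) → x∈p∩q⁺ (inV G e , u∈S)
  }

_-ᴳ_ : Graph n → Subset n → Graph n
G -ᴳ S = G [ V G ─ S ]

-- The spanning subgraph of H whose edges are the edges of H between A and B.
crossing : Graph n → Subset n → Subset n → Graph n
crossing H A B = record
  { V      = V H
  ; Adj    = λ u v → Adj H u v × ((u ∈ A × v ∈ B) ⊎ (u ∈ B × v ∈ A))
  ; adj?   = λ u v → adj? H u v ×-dec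
               (((u ∈? A) ×-dec (v ∈? B)) ⊎-dec ((u ∈? B) ×-dec (v ∈? A)))
  ; sym    = λ (e , c) → sym H e , Sum.map swap swap (Sum.swap c)
  ; irrefl = λ (e , _) → irrefl H e
  ; inV    = λ (e , _) → inV H e
  }

-- The graph without vertices is not connected.
Connected : Graph n → Set
Connected G = Nonempty (V G) × (∀ {u v} → u ∈ V G → v ∈ V G → Star (Adj G) u v)

-- Components are vertex sets: those of the maximal connected subgraphs.
IsComponent : Graph n → Subset n → Set
IsComponent G C =
  C ⊆ V G × Connected (G [ C ]) ×
  (∀ D → D ⊆ V G → Connected (G [ D ]) → C ⊆ D → D ⊆ C)

-- Two subgraphs H and H′ of G are adjacent.
Adjacent : Graph n → Graph n → Graph n → Set
Adjacent G H H′ = ∃[ u ] ∃[ v ] u ∈ V H × v ∈ V H′ × Adj G u v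

-- The cycle x, y₁, …, yₖ, x with k ≥ 2.
IsCycle : Graph n → Fin n → List (Fin n) → Set
IsCycle G x ys = 2 ≤ length ys × Unique (x ∷ ys) × Linked (Adj G) (x ∷ ys ∷ʳ x)

IsTree : Graph n → Set
IsTree G = Connected G × (∀ x ys → ¬ IsCycle G x ys)

record Expansion (t : ℕ) (F : Graph n) : Set₁ where
  field
    tree     : Fin t → Graph n
    isTree   : ∀ s → IsTree (tree s)
    disjoint : ∀ {s s′} → s ≢ s′ → Disjoint (V (tree s)) (V (tree s′))
    vertices : V F ≡ ⋃ (tabulate (V ∘ tree))
    -- No edge of F inside V (tree s) besides those of tree s.
    induced  : ∀ s → tree s ⊆ⁱ F
    joining  : ∀ {s s′} → s ≢ s′ →
               ∃! _≡_ λ ((u , v) : Fin n × Fin n) →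
                 u ∈ V (tree s) × v ∈ V (tree s′) × Adj F u v

open Expansion public

-- The colours of vertices outside V F are irrelevant.
IsOdd : ∀ {t} {F : Graph n} → Expansion t F → Set
IsOdd {n = n} {F = F} E = Σ[ colour ∈ (Fin n → Bool) ]
  (∀ s {u v} → Adj (tree E s) u v → colour u ≢ colour v) ×
  (∀ {s s′ u v} → s ≢ s′ → u ∈ V (tree E s) → v ∈ V (tree E s′) →
     Adj F u v → colour u ≡ colour v)

HasOddMinor : ℕ → Graph n → Set₁
HasOddMinor t G = ∃[ F ] F ⊆ᴳ G × Σ[ E ∈ Expansion t F ] IsOdd E

-- V (H 0) ∪ ⋯ ∪ V (H i), including i itself.
unionUpTo : ∀ {ℓ} → (Fin ℓ → Graph n) → Fin ℓ → Subset n
unionUpTo H i = ⋃ (take (suc (toℕ i)) (tabulate (V ∘ H)))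

AtMost : ∀ {ℓ} → ℕ → (Fin ℓ → Set) → Set
AtMost {ℓ} k P = Σ[ J ∈ Subset ℓ ] (∀ j → j ∈ J ⇔ P j) × ∣ J ∣ ≤ k

{-# OPTIONS --safe #-}

-- Remove the parts one at a time.  Let C be a component of what is left.  The
-- earlier parts adjacent to C are pairwise adjacent, and by (3) a vertex seeing a
-- part has neighbours of both colours in it, so adjacent parts are joined by
-- a monochromatic edge.  Spanning trees of the bipartite graphs in (2), together
-- with a properly coloured spanning tree of C, form an odd K_{k+1}-expansion if
-- there are k such parts; hence k ≤ t - 2.  Choose one vertex of C next to each
-- of these parts, and let the next part be a set joining these terminals
-- inside C, enlarged until (3) holds.
--
-- The joining set is found by recursion.  If every vertex is a terminal,
-- vertices are added one by one, each in the colour where it merges less.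
-- Otherwise a vertex u that is not a terminal is either superfluous or a cut
-- vertex, at which colourings of the two sides are glued.  The sizes add up because
-- the cluster of a prescribed root can be kept to ⌊k/2⌋ (or 1) instead of ⌈k/2⌉.

module Submission where

open import Defs
open import Data.Bool using (Bool; true; false; not; _xor_; if_then_else_)
open import Data.Bool.Properties as Bool using (not-¬)
open import Data.Fin using (Fin; zero; suc; toℕ; opposite) renaming (_≤_ to _≤ᶠ_; _<_ to _<ᶠ_)
open import Data.Fin.Properties using
  (_≟_; any?; all?; <-cmp; suc-injective; toℕ-injective; opposite-prop; opposite-involutive)
  renaming (_<?_ to _<ᶠ?_)
open import Data.Fin.Subset using
  (Subset; inside; outside; _∈_; _∉_; _⊆_; _⊂_; _∪_; _∩_; _─_; _-_; ⁅_⁆; ⋃; ∣_∣; Nonempty)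
  renaming (⊥ to ∅)
open import Data.Fin.Subset.Properties
open import Data.List using (List; []; _∷_; _∷ʳ_; tabulate)
open import Data.List.Relation.Unary.All as All using (All; []; _∷_)
open import Data.List.Relation.Unary.AllPairs using ([]; _∷_)
open import Data.List.Relation.Unary.Linked using (Linked; _∷_)
open import Data.List.Relation.Unary.Unique.Propositional using (Unique)
open import Data.Nat using (ℕ; zero; suc; _+_; _⊔_; _≤_; _<_; _∸_; ⌈_/2⌉; z≤n; s≤s; _≤?_)
open import Data.Nat.Properties as ℕ using (≤-refl; ≤-trans; ≤-reflexive)
open import Algebra.Properties.CommutativeSemigroup ℕ.+-commutativeSemigroup using (interchange)
open import Data.Product using (Σ-syntax; ∃-syntax; ∃!; _×_; _,_; proj₁; proj₂; swap)
open import Data.Product.Properties using (≡-dec)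
open import Data.Sum as Sum using (_⊎_; inj₁; inj₂; [_,_]′)
open import Data.Unit using (⊤; tt)
open import Data.Vec as Vec using ([]; _∷_)
import Data.Vec.Properties as Vec
open import Data.Vec.Functional using (updateAt) renaming (_∷_ to _∷ᶠ_)
open import Data.Vec.Functional.Properties using (updateAt-updates; updateAt-minimal)
open import Function using (_∘_; id; const; case_of_; mk⇔)
open import Relation.Binary using (Decidable; Symmetric; Tri; tri<; tri≈; tri>)
open import Relation.Binary.Construct.Closure.ReflexiveTransitive as Star using (Star; ε; _◅_; _◅◅_)
open import Relation.Binary.PropositionalEquality as ≡
  using (_≡_; _≢_; refl; cong; cong₂; subst; trans)
open import Relation.Nullary using (¬_; Dec; yes; no; does; contradiction; _×-dec_; _⊎-dec_; ¬?)
open import Relation.Nullary.Decidable as Dec using (decidable-stable; dec-true)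
import Relation.Unary as U

private
  variable
    n : ℕ

-- Finite subsets and their cardinalities.

∣p∪q∣+∣p∩q∣ : (p q : Subset n) → ∣ p ∪ q ∣ + ∣ p ∩ q ∣ ≡ ∣ p ∣ + ∣ q ∣
∣p∪q∣+∣p∩q∣ []            []            = refl
∣p∪q∣+∣p∩q∣ (inside ∷ p)  (inside ∷ q)  = cong suc
  (trans (ℕ.+-suc _ _) (trans (cong suc (∣p∪q∣+∣p∩q∣ p q)) (≡.sym (ℕ.+-suc _ _))))
∣p∪q∣+∣p∩q∣ (inside ∷ p)  (outside ∷ q) = cong suc (∣p∪q∣+∣p∩q∣ p q)
∣p∪q∣+∣p∩q∣ (outside ∷ p) (inside ∷ q)  =
  trans (cong suc (∣p∪q∣+∣p∩q∣ p q)) (≡.sym (ℕ.+-suc _ _))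
∣p∪q∣+∣p∩q∣ (outside ∷ p) (outside ∷ q) = ∣p∪q∣+∣p∩q∣ p q

∣p∪q∣≤∣p∣+∣q∣ : (p q : Subset n) → ∣ p ∪ q ∣ ≤ ∣ p ∣ + ∣ q ∣
∣p∪q∣≤∣p∣+∣q∣ p q = ≤-trans (ℕ.m≤m+n _ _) (≤-reflexive (∣p∪q∣+∣p∩q∣ p q))

x∈p∪⁅y⁆⁻ : {p : Subset n} {x y : Fin n} → x ∈ p ∪ ⁅ y ⁆ → x ∈ p ⊎ x ≡ y
x∈p∪⁅y⁆⁻ {p = p} {y = y} x∈ = [ inj₁ , inj₂ ∘ x∈⁅y⁆⇒x≡y y ]′ (x∈p∪q⁻ p ⁅ y ⁆ x∈)

p⊆p∪⁅x⁆ : {p : Subset n} {x : Fin n} → p ⊆ p ∪ ⁅ x ⁆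
p⊆p∪⁅x⁆ = p⊆p∪q _

x∈p∪⁅x⁆ : {p : Subset n} {x : Fin n} → x ∈ p ∪ ⁅ x ⁆
x∈p∪⁅x⁆ {p = p} {x} = q⊆p∪q p ⁅ x ⁆ (x∈⁅x⁆ x)

p∪⁅x⁆⊆ : {p q : Subset n} {x : Fin n} → p ⊆ q → x ∈ q → p ∪ ⁅ x ⁆ ⊆ q
p∪⁅x⁆⊆ p⊆q x∈q y∈ = [ p⊆q , (λ { refl → x∈q }) ]′ (x∈p∪⁅y⁆⁻ y∈)

⁅x⁆⊆ : {p : Subset n} {x : Fin n} → x ∈ p → ⁅ x ⁆ ⊆ p
⁅x⁆⊆ {x = x} x∈p y∈ with x∈⁅y⁆⇒x≡y x y∈
... | refl = x∈p

nonempty⇒1≤∣p∣ : {p : Subset n} {x : Fin n} → x ∈ p → 1 ≤ ∣ p ∣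
nonempty⇒1≤∣p∣ {x = x} x∈p =
  ≤-trans (≤-reflexive (≡.sym (∣⁅x⁆∣≡1 x)))
    (p⊆q⇒∣p∣≤∣q∣ (⁅x⁆⊆ x∈p))

∣p∪⁅x⁆∣≤ : (p : Subset n) (x : Fin n) → ∣ p ∪ ⁅ x ⁆ ∣ ≤ suc ∣ p ∣
∣p∪⁅x⁆∣≤ p x = ≤-trans (∣p∪q∣≤∣p∣+∣q∣ p ⁅ x ⁆)
  (≤-reflexive (trans (cong (∣ p ∣ +_) (∣⁅x⁆∣≡1 x)) (ℕ.+-comm _ 1)))

∣p∪⁅x⁆∣≥ : {p : Subset n} {x : Fin n} → x ∉ p → suc ∣ p ∣ ≤ ∣ p ∪ ⁅ x ⁆ ∣
∣p∪⁅x⁆∣≥ x∉p = p⊂q⇒∣p∣<∣q∣ (p⊆p∪⁅x⁆ , _ , x∈p∪⁅x⁆ , x∉p)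

x∈p─q⁻ : {p q : Subset n} {x : Fin n} → x ∈ p ─ q → x ∈ p × x ∉ q
x∈p─q⁻ {p = p} {q} x∈ = p─q⊆p p q x∈ , disjoint′ p q x∈
  where
  disjoint′ : ∀ {n} (p q : Subset n) {x} → x ∈ p ─ q → x ∉ q
  disjoint′ (_ ∷ p) (outside ∷ q) Vec.here       ()
  disjoint′ (_ ∷ p) (_ ∷ q)       (Vec.there x∈) (Vec.there x∈q) = disjoint′ p q x∈ x∈q

select : {P : Fin n → Set} → U.Decidable P → Subset n
select P? = Vec.tabulate (does ∘ P?)

∈-select⁺ : {P : Fin n → Set} (P? : U.Decidable P) {x : Fin n} → P x → x ∈ select P?
∈-select⁺ P? {x} px = Vec.lookup⇒[]= x _
  (trans (Vec.lookup∘tabulate (does ∘ P?) x) (dec-true (P? x) px))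

∈-select⁻ : {P : Fin n → Set} (P? : U.Decidable P) {x : Fin n} → x ∈ select P? → P x
∈-select⁻ P? {x} x∈ with P? x | trans (≡.sym (Vec.lookup∘tabulate (does ∘ P?) x)) (Vec.[]=⇒lookup x∈)
... | yes px | _  = px
... | no  _  | ()

⊈⇒∃ : {p q : Subset n} → ¬ p ⊆ q → ∃[ x ] x ∈ p × x ∉ q
⊈⇒∃ {p = p} {q} p⊈q with any? (λ x → (x ∈? p) ×-dec ¬? (x ∈? q))
... | yes w = w
... | no ¬w = contradiction
  (λ {x} x∈p → decidable-stable (x ∈? q) λ x∉q → ¬w (x , x∈p , x∉q)) p⊈q

∃-other : {p : Subset n} (x : Fin n) → 2 ≤ ∣ p ∣ → ∃[ y ] y ∈ p × y ≢ x
∃-other {p = p} x 2≤ with ⊈⇒∃ {p = p} {⁅ x ⁆}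
  (λ p⊆ → ℕ.<⇒≱ 2≤ (≤-trans (p⊆q⇒∣p∣≤∣q∣ p⊆) (≤-reflexive (∣⁅x⁆∣≡1 x))))
... | y , y∈p , y∉ = y , y∈p , x∉⁅y⁆⇒x≢y y∉

abstract
  -- Strict growth of `U` inside `Fin n` must end: `go` keeps `n < ∣ U ∣ + m`, so `m` cannot run out
  -- before `Done` is reached.
  climb : {Q : Subset n → Set} {Done : Set} →
    (∀ U → Q U → Done ⊎ (∃[ x ] x ∉ U × Q (U ∪ ⁅ x ⁆))) →
    ∀ U → Q U → Done
  climb {n} {Q} {Done} step U q = go (suc n) U (ℕ.m≤n+m (suc n) ∣ U ∣) q
    where
    go : ∀ m U → n < ∣ U ∣ + m → Q U → Done
    go zero    U n< q = contradiction (∣p∣≤n U) (ℕ.<⇒≱ (subst (n <_) (ℕ.+-identityʳ _) n<))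
    go (suc m) U n< q with step U q
    ... | inj₁ d            = d
    ... | inj₂ (x , x∉ , q′) = go m (U ∪ ⁅ x ⁆)
      (≤-trans n< (≤-trans (≤-reflexive (ℕ.+-suc _ m)) (ℕ.+-monoˡ-≤ m (∣p∪⁅x⁆∣≥ x∉)))) q′

-- Connectivity of vertex sets under an edge relation.

Within : (Fin n → Fin n → Set) → Subset n → Fin n → Fin n → Set
Within R D u v = R u v × u ∈ D × v ∈ D

-- Unlike `Connected`, this holds for the empty set; nonemptiness is carried separately.
Conn : (Fin n → Fin n → Set) → Subset n → Set
Conn R D = ∀ {u v} → u ∈ D → v ∈ D → Star (Within R D) u v

module _ {R R′ : Fin n → Fin n → Set} where

  Conn-map : ∀ {D} → (∀ {a b} → a ∈ D → b ∈ D → R a b → R′ a b) → Conn R D → Conn R′ D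
  Conn-map f conn u∈ v∈ = Star.map (λ (r , a∈ , b∈) → f a∈ b∈ r , a∈ , b∈) (conn u∈ v∈)

module _ {R : Fin n → Fin n → Set} where

  Within-mono : ∀ {D D′} → D ⊆ D′ → ∀ {u v} → Star (Within R D) u v → Star (Within R D′) u v
  Within-mono D⊆ = Star.map λ (r , a∈ , b∈) → r , D⊆ a∈ , D⊆ b∈

  Conn-⁅⁆ : ∀ v → Conn R ⁅ v ⁆
  Conn-⁅⁆ v u∈ w∈ with x∈⁅y⁆⇒x≡y v u∈ | x∈⁅y⁆⇒x≡y v w∈
  ... | refl | refl = ε

  closed-star : {D : Subset n} {P : Fin n → Set} →
    (∀ {a b} → a ∈ D → b ∈ D → R a b → P a → P b) →
    ∀ {u v} → Star (Within R D) u v → P u → P v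
  closed-star cl ε                      pu = pu
  closed-star cl ((r , a∈ , b∈) ◅ path) pu = closed-star cl path (cl a∈ b∈ r pu)

  exit : {D : Subset n} {P : Fin n → Set} → U.Decidable P →
    ∀ {u v} → Star (Within R D) u v → P u → ¬ P v →
    ∃[ a ] ∃[ b ] R a b × a ∈ D × b ∈ D × P a × ¬ P b
  exit P? ε pu ¬pv = contradiction pu ¬pv
  exit P? {u} (_◅_ {j = b} (r , u∈ , b∈) path) pu ¬pv with P? b
  ... | yes pb = exit P? path pb ¬pv
  ... | no ¬pb = u , b , r , u∈ , b∈ , pu , ¬pb

  module _ (R-sym : Symmetric R) where

    Within-sym : ∀ {D} → Symmetric (Within R D)
    Within-sym (r , a∈ , b∈) = R-sym r , b∈ , a∈

    Conn-hub : ∀ {D z} → (∀ {u} → u ∈ D → Star (Within R D) u z) → Conn R D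
    Conn-hub hub u∈ v∈ = hub u∈ ◅◅ Star.reverse Within-sym (hub v∈)

    Conn-∪ : ∀ {D D′ z} → z ∈ D → z ∈ D′ → Conn R D → Conn R D′ → Conn R (D ∪ D′)
    Conn-∪ {D} {D′} {z} z∈ z∈′ c c′ = Conn-hub λ u∈ →
      [ (λ u∈D → Within-mono (p⊆p∪q D′) (c u∈D z∈))
      , (λ u∈D′ → Within-mono (q⊆p∪q D D′) (c′ u∈D′ z∈′)) ]′ (x∈p∪q⁻ D D′ u∈)

    Conn-extend : ∀ {D x y} → Conn R D → y ∈ D → R y x → Conn R (D ∪ ⁅ x ⁆)
    Conn-extend {D} {x} {y} c y∈ r = Conn-hub {z = y} λ u∈ → case x∈p∪⁅y⁆⁻ u∈ of λ where
      (inj₁ u∈D)  → Within-mono p⊆p∪⁅x⁆ (c u∈D y∈)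
      (inj₂ refl) → (R-sym r , x∈p∪⁅x⁆ , p⊆p∪⁅x⁆ y∈) ◅ ε

  module _ (R? : Decidable R) (W : Subset n) {v : Fin n} (v∈W : v ∈ W) where

    -- A search from `v` along `R`, one vertex at a time, carries along any property `P` that
    -- survives such an addition. Connected components, good colourings and rooted spanning trees
    -- all arise this way.
    grow : (P : Subset n → Set) → P ⁅ v ⁆ →
      (∀ {U x y} → v ∈ U → U ⊆ W → P U → y ∈ U → x ∈ W → x ∉ U → R y x → P (U ∪ ⁅ x ⁆)) →
      ∃[ U ] P U × v ∈ U × U ⊆ W × (∀ {a b} → a ∈ U → b ∈ W → R a b → b ∈ U)
    grow P base step = climb {Q = Q} step′ ⁅ v ⁆
      (base , x∈⁅x⁆ v , ⁅x⁆⊆ v∈W)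
      where
      Q : Subset n → Set
      Q U = P U × v ∈ U × U ⊆ W

      step′ : ∀ U → Q U →
        (∃[ U ] P U × v ∈ U × U ⊆ W × (∀ {a b} → a ∈ U → b ∈ W → R a b → b ∈ U)) ⊎
        (∃[ x ] x ∉ U × Q (U ∪ ⁅ x ⁆))
      step′ U (pU , v∈ , U⊆) with any? (λ y → any? λ x →
        (y ∈? U) ×-dec (x ∈? W) ×-dec ¬? (x ∈? U) ×-dec R? y x)
      ... | yes (y , x , y∈ , x∈ , x∉ , r) = inj₂ (x , x∉ , step v∈ U⊆ pU y∈ x∈ x∉ r , p⊆p∪⁅x⁆ v∈ ,
        p∪⁅x⁆⊆ U⊆ x∈)
      ... | no ¬e = inj₁ (U , pU , v∈ , U⊆ , λ {a} {b} a∈ b∈ r →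
        decidable-stable (b ∈? U) λ b∉ → ¬e (a , b , a∈ , b∈ , b∉ , r))

    grow-all : (P : Subset n → Set) → P ⁅ v ⁆ →
      (∀ {U x y} → v ∈ U → U ⊆ W → P U → y ∈ U → x ∈ W → x ∉ U → R y x → P (U ∪ ⁅ x ⁆)) →
      Conn R W → P W
    grow-all P base step conn with grow P base step
    ... | U , pU , v∈ , U⊆ , closed = subst P
      (⊆-antisym U⊆ λ w∈ → closed-star {P = _∈ U} (λ _ b∈ r a∈ → closed a∈ b∈ r) (conn v∈W w∈) v∈) pU

    abstract
      component : Symmetric R →
        ∃[ L ] Conn R L × v ∈ L × L ⊆ W × (∀ {a b} → a ∈ L → b ∈ W → R a b → b ∈ L)
      component R-sym = grow (Conn R) (Conn-⁅⁆ v) λ _ _ conn y∈ _ _ → Conn-extend R-sym conn y∈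

-- Arithmetic of doubled sizes: `∣ D ∣ + ∣ D ∣ ≤ suc k` stands for `∣ D ∣ ≤ ⌈ k /2⌉`.

double-cancel : ∀ {a b m p} → a + b ≤ m → p ≤ a + a → (b + b) + p ≤ m + m
double-cancel {a} {b} {m} {p} a+b≤m p≤a+a = begin
  (b + b) + p       ≤⟨ ℕ.+-monoʳ-≤ (b + b) p≤a+a ⟩
  (b + b) + (a + a) ≡⟨ ℕ.+-comm (b + b) (a + a) ⟩
  (a + a) + (b + b) ≡⟨ interchange a a b b ⟩
  (a + b) + (a + b) ≤⟨ ℕ.+-mono-≤ a+b≤m a+b≤m ⟩
  m + m             ∎
  where open ℕ.≤-Reasoning

-- Made for a cluster cut into two parts that share one vertex: the shared vertex is counted twice,
-- which saves 2 in the doubled size.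
double-merge : ∀ {d d₁ d₂ p q m} → suc d ≤ d₁ + d₂ → d₁ + d₁ ≤ p → d₂ + d₂ ≤ q →
  p + q ≤ suc (suc m) → d + d ≤ m
double-merge {d} {d₁} {d₂} {p} {q} {m} d<d₁+d₂ ≤p ≤q p+q≤ = ℕ.≤-pred (ℕ.≤-pred (begin
  suc (suc (d + d))       ≡⟨ cong suc (ℕ.+-suc d d) ⟨
  suc d + suc d           ≤⟨ ℕ.+-mono-≤ d<d₁+d₂ d<d₁+d₂ ⟩
  (d₁ + d₂) + (d₁ + d₂)   ≡⟨ interchange d₁ d₂ d₁ d₂ ⟩
  (d₁ + d₁) + (d₂ + d₂)   ≤⟨ ℕ.+-mono-≤ ≤p ≤q ⟩
  p + q                   ≤⟨ p+q≤ ⟩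
  suc (suc m)             ∎))
  where open ℕ.≤-Reasoning

-- Two-colourings with connected crossing graph and small monochromatic clusters.

module Colouring (G : Graph n) where

  E : Fin n → Fin n → Set
  E = Adj G

  Mono Cross : (Fin n → Bool) → Fin n → Fin n → Set
  Mono  c u v = E u v × c u ≡ c v
  Cross c u v = E u v × c u ≢ c v

  mono? : ∀ c → Decidable (Mono c)
  mono? c u v = adj? G u v ×-dec (c u Bool.≟ c v)

  cross? : ∀ c → Decidable (Cross c)
  cross? c u v = adj? G u v ×-dec ¬? (c u Bool.≟ c v)

  mono-sym : ∀ c → Symmetric (Mono c)
  mono-sym c (e , eq) = sym G e , ≡.sym eq

  cross-sym : ∀ c → Symmetric (Cross c)
  cross-sym c (e , neq) = sym G e , neq ∘ ≡.sym

  -- The bound at the root is what makes gluing along a cut vertex lossless.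
  record Good (c : Fin n → Bool) (W : Subset n) (v : Fin n) (k : ℕ) : Set where
    field
      crossing-conn : Conn (Cross c) W
      clusters      : ∀ {D} → D ⊆ W → Conn (Mono c) D → ∣ D ∣ + ∣ D ∣ ≤ suc k
      root-cluster  : ∀ {D} → D ⊆ W → v ∈ D → Conn (Mono c) D → ∣ D ∣ + ∣ D ∣ ≤ k ⊔ 2
  open Good

  Good-mono : ∀ {c W v k k′} → k ≤ k′ → Good c W v k → Good c W v k′
  Good-mono k≤ g = record
    { crossing-conn = crossing-conn g
    ; clusters      = λ D⊆ conn → ≤-trans (clusters g D⊆ conn) (s≤s k≤)
    ; root-cluster  = λ D⊆ v∈ conn → ≤-trans (root-cluster g D⊆ v∈ conn) (ℕ.⊔-monoˡ-≤ 2 k≤)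
    }

  -- `x` is coloured `β` and joins `U`. A monochromatic connected set that avoids `x` is an old one,
  -- and one that contains `x` lies in `cluster`; so `cluster` alone decides whether the size bounds
  -- survive.
  module Paint {c : Fin n → Bool} {U : Subset n} {x : Fin n} (x∉U : x ∉ U) (β : Bool) where

    painted : Fin n → Bool
    painted = updateAt c x (const β)

    painted-x : painted x ≡ β
    painted-x = updateAt-updates x c

    painted-U : ∀ {u} → u ∈ U → painted u ≡ c u
    painted-U {u} u∈ = updateAt-minimal u x c λ { refl → x∉U u∈ }

    painted-crossing : ∀ {y} → Conn (Cross c) U → y ∈ U → E y x → c y ≢ β →
      Conn (Cross painted) (U ∪ ⁅ x ⁆)
    painted-crossing conn y∈ e cy≢β = Conn-extend (cross-sym painted)
      (Conn-map (λ a∈ b∈ (e , neq) → e , λ eq →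
        neq (trans (≡.sym (painted-U a∈)) (trans eq (painted-U b∈)))) conn)
      y∈ (e , λ eq → cy≢β (trans (≡.sym (painted-U y∈)) (trans eq painted-x)))

    painted-mono : ∀ {D} → D ⊆ U → Conn (Mono painted) D → Conn (Mono c) D
    painted-mono D⊆ = Conn-map λ a∈ b∈ (e , eq) →
      e , trans (≡.sym (painted-U (D⊆ a∈))) (trans eq (painted-U (D⊆ b∈)))

    avoids : ∀ {D} → D ⊆ U ∪ ⁅ x ⁆ → x ∉ D → D ⊆ U
    avoids D⊆ x∉ a∈ = [ id , (λ { refl → contradiction a∈ x∉ }) ]′ (x∈p∪⁅y⁆⁻ (D⊆ a∈))

    private
      comp = component (mono? painted) (U ∪ ⁅ x ⁆) (x∈p∪⁅x⁆ {p = U} {x}) (mono-sym painted)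

    cluster : Subset n
    cluster = proj₁ comp

    cluster-conn : Conn (Mono painted) cluster
    cluster-conn = proj₁ (proj₂ comp)

    x∈cluster : x ∈ cluster
    x∈cluster = proj₁ (proj₂ (proj₂ comp))

    cluster⊆ : cluster ⊆ U ∪ ⁅ x ⁆
    cluster⊆ = proj₁ (proj₂ (proj₂ (proj₂ comp)))

    ⊆cluster : ∀ {D} → D ⊆ U ∪ ⁅ x ⁆ → x ∈ D → Conn (Mono painted) D → D ⊆ cluster
    ⊆cluster D⊆ x∈ conn a∈ = closed-star {P = _∈ cluster}
      (λ _ b∈ r a∈ → proj₂ (proj₂ (proj₂ (proj₂ comp))) a∈ (D⊆ b∈) r) (conn x∈ a∈) x∈cluster

    cluster-colour : ∀ {a} → a ∈ cluster → painted a ≡ β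
    cluster-colour a∈ = closed-star {P = λ a → painted a ≡ β}
      (λ _ _ (_ , eq) pa → trans (≡.sym eq) pa) (cluster-conn x∈cluster a∈) painted-x

    -- On a path inside the cluster from `x` to another vertex, some step leaves `x` and yields the
    -- neighbour. If `x` is given the other colour instead, the edge to this neighbour crosses.
    cluster-nbr : 2 ≤ ∣ cluster ∣ → ∃[ w ] w ∈ U × E w x × c w ≡ β
    cluster-nbr 2≤ with ∃-other x 2≤
    ... | y , y∈ , y≢x with exit (_≟ x) (cluster-conn x∈cluster y∈) refl y≢x
    ... | _ , w , (e , _) , _ , w∈ , refl , w≢x with x∈p∪⁅y⁆⁻ (cluster⊆ w∈)
    ... | inj₁ w∈U = w , w∈U , sym G e , trans (≡.sym (painted-U w∈U)) (cluster-colour w∈)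
    ... | inj₂ w≡x = contradiction w≡x w≢x

    Good-paint : ∀ {y v k} → Good c U v k → y ∈ U → E y x → c y ≢ β →
      ∣ cluster ∣ + ∣ cluster ∣ ≤ suc (suc k) →
      (v ∈ cluster → ∣ cluster ∣ + ∣ cluster ∣ ≤ suc k ⊔ 2) →
      Good painted (U ∪ ⁅ x ⁆) v (suc k)
    Good-paint {v = v} {k} g y∈ e cy≢β small small-root = record
      { crossing-conn = painted-crossing (crossing-conn g) y∈ e cy≢β
      ; clusters = λ {D} D⊆ conn → case x ∈? D of λ where
          (yes x∈) → let le = p⊆q⇒∣p∣≤∣q∣ (⊆cluster D⊆ x∈ conn) in ≤-trans (ℕ.+-mono-≤ le le) small
          (no x∉)  → ℕ.m≤n⇒m≤1+n (clusters g (avoids D⊆ x∉) (painted-mono (avoids D⊆ x∉) conn))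
      ; root-cluster = λ {D} D⊆ v∈ conn → case x ∈? D of λ where
          (yes x∈) → let sub = ⊆cluster D⊆ x∈ conn; le = p⊆q⇒∣p∣≤∣q∣ sub in
                     ≤-trans (ℕ.+-mono-≤ le le) (small-root (sub v∈))
          (no x∉)  → ≤-trans (root-cluster g (avoids D⊆ x∉) v∈ (painted-mono (avoids D⊆ x∉) conn))
                       (ℕ.⊔-monoˡ-≤ 2 (ℕ.n≤1+n k))
      }

  -- The two candidate clusters of x meet only in x, so they cannot both be too large.
  Good-step : ∀ {c U v x y} → v ∈ U → Good c U v ∣ U ∣ → y ∈ U → x ∉ U → E y x →
    ∃[ c′ ] Good c′ (U ∪ ⁅ x ⁆) v (suc ∣ U ∣)
  Good-step {c} {U} {v} {x} {y} v∈ g y∈ x∉ e = choose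
    (s₁ + s₁ ≤? suc (suc k)) (v ∈? K₁) (s₁ + s₁ ≤? suc k ⊔ 2)
    where
    -- `P₁` gives `x` the colour opposite to `y`, so the edge to `y` crosses; `P₂` gives it the
    -- colour of `y` and needs a different crossing edge.
    module P₁ = Paint {c} x∉ (not (c y))
    module P₂ = Paint {c} x∉ (c y)
    K₁ = P₁.cluster
    K₂ = P₂.cluster
    s₁ = ∣ K₁ ∣
    s₂ = ∣ K₂ ∣
    k  = ∣ U ∣

    1≤k : 1 ≤ k
    1≤k = nonempty⇒1≤∣p∣ v∈

    meet : ∀ {a} → a ∈ K₁ → a ∈ K₂ → a ≡ x
    meet {a} a∈₁ a∈₂ with x∈p∪⁅y⁆⁻ (P₁.cluster⊆ a∈₁)
    ... | inj₂ a≡x = a≡x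
    ... | inj₁ a∈U = contradiction
      (trans (≡.sym (trans (≡.sym (P₂.painted-U a∈U)) (P₂.cluster-colour a∈₂)))
             (trans (≡.sym (P₁.painted-U a∈U)) (P₁.cluster-colour a∈₁)))
      (not-¬ refl)

    sum : s₁ + s₂ ≤ suc (suc k)
    sum = ≤-trans (≤-reflexive (≡.sym (∣p∪q∣+∣p∩q∣ K₁ K₂))) (≤-trans
      (ℕ.+-mono-≤
        (≤-trans (p⊆q⇒∣p∣≤∣q∣ λ a∈ → [ P₁.cluster⊆ , P₂.cluster⊆ ]′ (x∈p∪q⁻ K₁ K₂ a∈)) (∣p∪⁅x⁆∣≤ U x))
        (≤-trans (p⊆q⇒∣p∣≤∣q∣ {q = ⁅ x ⁆} λ a∈ → let a₁ , a₂ = x∈p∩q⁻ K₁ K₂ a∈ in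
            subst (_∈ ⁅ x ⁆) (≡.sym (meet a₁ a₂)) (x∈⁅x⁆ x)) (≤-reflexive (∣⁅x⁆∣≡1 x))))
      (≤-reflexive (ℕ.+-comm (suc k) 1)))

    second : suc (suc k) ≤ s₁ + s₁ → (v ∈ K₂ → s₂ + s₂ ≤ suc k ⊔ 2) → ∃[ c′ ] Good c′ (U ∪ ⁅ x ⁆) v (suc k)
    -- A large `K₁` contains a neighbour `w` of `x` coloured `not (c y)`, so under `P₂` the edge
    -- from `w` to `x` crosses. By `sum`, a doubled size of at least `k + 2` for `K₁` leaves at most
    -- `k + 2` for `K₂`.
    second big₁ root₂ with P₁.cluster-nbr (2≤ big₁)
      where
      2≤ : ∀ {s} → suc (suc k) ≤ s + s → 2 ≤ s
      2≤ {suc (suc _)} _ = s≤s (s≤s z≤n)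
      2≤ {suc zero} (s≤s (s≤s k≤0)) = contradiction (≤-trans 1≤k k≤0) λ ()
    ... | w , w∈ , e′ , cw = _ , P₂.Good-paint g w∈ e′ (λ eq → not-¬ eq cw)
      (ℕ.+-cancelʳ-≤ (suc (suc k)) _ _ (double-cancel {s₁} sum big₁)) root₂

    choose : Dec (s₁ + s₁ ≤ suc (suc k)) → Dec (v ∈ K₁) → Dec (s₁ + s₁ ≤ suc k ⊔ 2) →
      ∃[ c′ ] Good c′ (U ∪ ⁅ x ⁆) v (suc k)
    choose (yes p) (no v∉) _ = _ , P₁.Good-paint g y∈ e (not-¬ refl) p λ v∈ → contradiction v∈ v∉
    choose (yes p) (yes _) (yes q) = _ , P₁.Good-paint g y∈ e (not-¬ refl) p λ _ → q
    -- `K₁` breaks only the root bound. It contains `v`, which differs from `x`, and the two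
    -- candidates meet only in `x`, so `K₂` does not contain the root.
    choose (yes _) (yes v∈₁) (no ¬q) = second
      (≤-trans (s≤s (ℕ.m≤m⊔n (suc k) 2)) (ℕ.≰⇒> ¬q))
      λ v∈₂ → contradiction v∈ (subst (_∉ U) (≡.sym (meet v∈₁ v∈₂)) x∉)
    -- Here the doubled size of `K₁` is at least `k + 3`, so that of `K₂` is at most `k + 1`, which
    -- meets the root bound as well.
    choose (no ¬p) _ _ = second (ℕ.<⇒≤ (ℕ.≰⇒> ¬p)) λ _ → ≤-trans
      (ℕ.+-cancelʳ-≤ (suc (suc (suc k))) _ _ (≤-trans (double-cancel {s₁} sum (ℕ.≰⇒> ¬p))
        (≤-reflexive (≡.sym (ℕ.+-suc (suc k) (suc (suc k)))))))
      (ℕ.m≤m⊔n (suc k) 2)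

  abstract
    -- The case in which every vertex is a terminal: `Good-step` adds the vertices of `W` in the
    -- order of a search from `v`.
    Good-spanning : ∀ {W v} → v ∈ W → Conn E W → ∃[ c ] Good c W v ∣ W ∣
    Good-spanning {W} {v} v∈ = grow-all (adj? G) W v∈ (λ U → ∃[ c ] Good c U v ∣ U ∣)
      (const false , record
        { crossing-conn = Conn-⁅⁆ v
        ; clusters      = λ D⊆ _ → ≤-trans (single D⊆) (s≤s (≤-reflexive (≡.sym (∣⁅x⁆∣≡1 v))))
        -- The root alone has doubled size 2 although `k` is 1; the maximum with 2 in the root bound
        -- admits it.
        ; root-cluster  = λ D⊆ _ _ → ≤-trans (single D⊆) (ℕ.m≤n⊔m ∣ ⁅ v ⁆ ∣ 2)
        })
      λ v∈U U⊆ (c , g) y∈ x∈ x∉ e → let c′ , g′ = Good-step v∈U g y∈ x∉ e in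
        c′ , Good-mono (∣p∪⁅x⁆∣≥ x∉) g′
      where
      single : ∀ {D} → D ⊆ ⁅ v ⁆ → ∣ D ∣ + ∣ D ∣ ≤ 2
      single D⊆ = let le = ≤-trans (p⊆q⇒∣p∣≤∣q∣ D⊆) (≤-reflexive (∣⁅x⁆∣≡1 v)) in ℕ.+-mono-≤ le le

  -- Gluing at a cut vertex, joining sets for terminals, and saturation.

  Conn-part : ∀ {R : Fin n → Fin n → Set} → Symmetric R → ∀ {D X Y u} →
    D ⊆ X ∪ Y → (∀ {a b} → a ∈ X → b ∈ Y → R a b → a ≡ u ⊎ b ≡ u) → u ∈ X →
    u ∈ D → Conn R D → Conn R (D ∩ X)
  Conn-part {R} R-sym {D} {X} {Y} {u} D⊆ sep u∈X u∈D conn = Conn-hub R-sym λ a∈ →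
    let a∈D , a∈X = x∈p∩q⁻ D X a∈ in walk (conn a∈D u∈D) a∈X
    where
    -- A path towards `u` can leave `X` only from `u` itself, so it is cut at its first visit to
    -- `u`.
    walk : ∀ {a} → Star (Within R D) a u → a ∈ X → Star (Within R (D ∩ X)) a u
    walk ε a∈ = ε
    walk {a} (_◅_ {j = b} (r , a∈D , b∈D) path) a∈ with a ≟ u
    ... | yes refl = ε
    ... | no a≢u   = (r , x∈p∩q⁺ (a∈D , a∈) , x∈p∩q⁺ (b∈D , b∈)) ◅ walk path b∈
      where
      b∈ : b ∈ X
      b∈ = case x∈p∪q⁻ X Y (D⊆ b∈D) of λ where
        (inj₁ b∈X) → b∈X
        (inj₂ b∈Y) → case sep a∈ b∈Y r of λ where
          (inj₁ a≡u)  → contradiction a≡u a≢u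
          (inj₂ refl) → u∈X

  -- In the application `k₁` and `k₂` count the terminals on the two sides without `u`, and each
  -- side counts `u` once more. In `X₂` the vertex `u` is the root, so the part there of a cluster
  -- through `u` obeys the stricter bound; this makes up for counting `u` on both sides.
  Good-glue : ∀ {c₁ c₂ X₁ X₂ u v k₁ k₂ k} → u ∈ X₁ → u ∈ X₂ →
    (∀ {a} → a ∈ X₁ → a ∈ X₂ → a ≡ u) →
    (∀ {a b} → a ∈ X₁ → b ∈ X₂ → E a b → a ≡ u ⊎ b ≡ u) →
    v ∉ X₂ → 1 ≤ k₁ → 1 ≤ k₂ → k₁ + k₂ ≤ k →
    Good c₁ X₁ v (suc k₁) → Good c₂ X₂ u (suc k₂) →
    ∃[ c ] Good c (X₁ ∪ X₂) v k
  Good-glue {c₁} {c₂} {X₁} {X₂} {u} {v} {k₁} {k₂} {k} u∈₁ u∈₂ meet sep v∉₂ 1≤k₁ 1≤k₂ sum g₁ g₂ =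
    c , record
      { crossing-conn = Conn-∪ (cross-sym c) u∈₁ u∈₂
          (Conn-map (λ a∈ b∈ (e , neq) → e , λ eq → neq (same₁ a∈ b∈ eq)) (crossing-conn g₁))
          (Conn-map (λ a∈ b∈ (e , neq) → e , λ eq → neq (same₂ a∈ b∈ eq)) (crossing-conn g₂))
      ; clusters = λ {D} D⊆ conn → case locate D⊆ conn of λ where
          (inj₁ D⊆₁) → ≤-trans (clusters g₁ D⊆₁ (mono₁ D⊆₁ conn)) (s≤s k₁<k)
          (inj₂ (inj₁ D⊆₂)) → ≤-trans (clusters g₂ D⊆₂ (mono₂ D⊆₂ conn)) (s≤s k₂<k)
          -- Doubled, the two parts are at most `k₁ + 2` and `k₂ + 1`, and `u` lies in both; this
          -- leaves `k₁ + k₂ + 1 ≤ k + 1`. The maximum with 2 disappears because `1 ≤ k₂`.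
          (inj₂ (inj₂ u∈D)) → double-merge {d₁ = ∣ D ∩ X₁ ∣} {∣ D ∩ X₂ ∣} (shared D⊆ u∈D)
            (clusters g₁ (p∩q⊆q D X₁) (part₁ D⊆ u∈D conn))
            (root-cluster g₂ (p∩q⊆q D X₂) (x∈p∩q⁺ (u∈D , u∈₂)) (part₂ D⊆ u∈D conn))
            (≤-trans (≤-reflexive (cong (λ z → suc (suc k₁) + z) (ℕ.m≥n⇒m⊔n≡m (s≤s 1≤k₂))))
              (s≤s (s≤s (≤-trans (≤-reflexive (ℕ.+-suc k₁ k₂)) (s≤s sum)))))
      ; root-cluster = λ {D} D⊆ v∈ conn → case locate D⊆ conn of λ where
          (inj₁ D⊆₁) → ≤-trans (root-cluster g₁ D⊆₁ v∈ (mono₁ D⊆₁ conn)) (ℕ.⊔-monoˡ-≤ 2 k₁<k)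
          (inj₂ (inj₁ D⊆₂)) → contradiction (D⊆₂ v∈) v∉₂
          -- Now the root bound holds for both parts: at most `k₁ + 1` and `k₂ + 1`, which leaves at
          -- most `k`.
          (inj₂ (inj₂ u∈D)) → ≤-trans (double-merge {d₁ = ∣ D ∩ X₁ ∣} {∣ D ∩ X₂ ∣} (shared D⊆ u∈D)
            (root-cluster g₁ (p∩q⊆q D X₁) (x∈p∩q⁺ (v∈ , v∈X₁ (D⊆ v∈))) (part₁ D⊆ u∈D conn))
            (root-cluster g₂ (p∩q⊆q D X₂) (x∈p∩q⁺ (u∈D , u∈₂)) (part₂ D⊆ u∈D conn))
            (≤-trans (≤-reflexive (cong₂ _+_ (ℕ.m≥n⇒m⊔n≡m (s≤s 1≤k₁)) (ℕ.m≥n⇒m⊔n≡m (s≤s 1≤k₂))))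
              (s≤s (≤-trans (≤-reflexive (ℕ.+-suc k₁ k₂)) (s≤s sum)))))
            (ℕ.m≤m⊔n k 2)
      }
    where
    k₁<k : suc k₁ ≤ k
    k₁<k = ≤-trans (≤-trans (≤-reflexive (ℕ.+-comm 1 k₁)) (ℕ.+-monoʳ-≤ k₁ 1≤k₂)) sum

    k₂<k : suc k₂ ≤ k
    k₂<k = ≤-trans (ℕ.+-monoˡ-≤ k₂ 1≤k₁) sum

    -- If the colourings disagree at `u`, the two colours are exchanged on `X₂`, which changes
    -- neither `Mono` nor `Cross` there.
    flip : Bool
    flip = c₁ u xor c₂ u

    c : Fin n → Bool
    c w = if does (w ∈? X₂) then c₂ w xor flip else c₁ w

    xor-flip : ∀ x y → y xor (x xor y) ≡ x
    xor-flip false false = refl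
    xor-flip false true  = refl
    xor-flip true  false = refl
    xor-flip true  true  = refl

    xor-cancel : ∀ x y z → x xor z ≡ y xor z → x ≡ y
    xor-cancel false false z     _  = refl
    xor-cancel true  true  z     _  = refl
    xor-cancel false true  false ()
    xor-cancel false true  true  ()
    xor-cancel true  false false ()
    xor-cancel true  false true  ()

    c-X₁ : ∀ {w} → w ∈ X₁ → c w ≡ c₁ w
    c-X₁ {w} w∈ with w ∈? X₂
    ... | no _ = refl
    ... | yes w∈₂ with meet w∈ w∈₂
    ... | refl = xor-flip (c₁ u) (c₂ u)

    c-X₂ : ∀ {w} → w ∈ X₂ → c w ≡ c₂ w xor flip
    c-X₂ {w} w∈ with w ∈? X₂
    ... | yes _  = refl
    ... | no w∉  = contradiction w∈ w∉

    same₁ : ∀ {a b} → a ∈ X₁ → b ∈ X₁ → c a ≡ c b → c₁ a ≡ c₁ b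
    same₁ a∈ b∈ eq = trans (≡.sym (c-X₁ a∈)) (trans eq (c-X₁ b∈))

    same₂ : ∀ {a b} → a ∈ X₂ → b ∈ X₂ → c a ≡ c b → c₂ a ≡ c₂ b
    same₂ a∈ b∈ eq = xor-cancel _ _ flip (trans (≡.sym (c-X₂ a∈)) (trans eq (c-X₂ b∈)))

    mono₁ : ∀ {D} → D ⊆ X₁ → Conn (Mono c) D → Conn (Mono c₁) D
    mono₁ D⊆ = Conn-map λ a∈ b∈ (e , eq) → e , same₁ (D⊆ a∈) (D⊆ b∈) eq

    mono₂ : ∀ {D} → D ⊆ X₂ → Conn (Mono c) D → Conn (Mono c₂) D
    mono₂ D⊆ = Conn-map λ a∈ b∈ (e , eq) → e , same₂ (D⊆ a∈) (D⊆ b∈) eq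

    v∈X₁ : v ∈ X₁ ∪ X₂ → v ∈ X₁
    v∈X₁ v∈ = [ id , (λ v∈₂ → contradiction v∈₂ v∉₂) ]′ (x∈p∪q⁻ X₁ X₂ v∈)

    part₁ : ∀ {D} → D ⊆ X₁ ∪ X₂ → u ∈ D → Conn (Mono c) D → Conn (Mono c₁) (D ∩ X₁)
    part₁ {D} D⊆ u∈ conn = mono₁ (p∩q⊆q D X₁)
      (Conn-part (mono-sym c) D⊆ (λ a∈ b∈ (e , _) → sep a∈ b∈ e) u∈₁ u∈ conn)

    part₂ : ∀ {D} → D ⊆ X₁ ∪ X₂ → u ∈ D → Conn (Mono c) D → Conn (Mono c₂) (D ∩ X₂)
    part₂ {D} D⊆ u∈ conn = mono₂ (p∩q⊆q D X₂)
      (Conn-part (mono-sym c) (λ a∈ → x∈p∪q⁺ (Sum.swap (x∈p∪q⁻ X₁ X₂ (D⊆ a∈))))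
        (λ a∈ b∈ (e , _) → Sum.swap (sep b∈ a∈ (sym G e))) u∈₂ u∈ conn)

    shared : ∀ {D} → D ⊆ X₁ ∪ X₂ → u ∈ D → suc ∣ D ∣ ≤ ∣ D ∩ X₁ ∣ + ∣ D ∩ X₂ ∣
    shared {D} D⊆ u∈ = begin
      suc ∣ D ∣                                          ≡⟨ ℕ.+-comm 1 ∣ D ∣ ⟩
      ∣ D ∣ + 1                                          ≤⟨ ℕ.+-mono-≤ (p⊆q⇒∣p∣≤∣q∣ D⊆∪) (nonempty⇒1≤∣p∣ u∈∩) ⟩
      ∣ D ∩ X₁ ∪ D ∩ X₂ ∣ + ∣ (D ∩ X₁) ∩ (D ∩ X₂) ∣      ≡⟨ ∣p∪q∣+∣p∩q∣ (D ∩ X₁) (D ∩ X₂) ⟩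
      ∣ D ∩ X₁ ∣ + ∣ D ∩ X₂ ∣                            ∎
      where
      open ℕ.≤-Reasoning
      D⊆∪ : D ⊆ D ∩ X₁ ∪ D ∩ X₂
      D⊆∪ a∈ = x∈p∪q⁺ (Sum.map (λ a∈₁ → x∈p∩q⁺ (a∈ , a∈₁)) (λ a∈₂ → x∈p∩q⁺ (a∈ , a∈₂)) (x∈p∪q⁻ X₁ X₂ (D⊆ a∈)))
      u∈∩ : u ∈ (D ∩ X₁) ∩ (D ∩ X₂)
      u∈∩ = x∈p∩q⁺ (x∈p∩q⁺ (u∈ , u∈₁) , x∈p∩q⁺ (u∈ , u∈₂))

    -- An edge between the two sides has `u` as an end, so a connected set that avoids `u` stays on
    -- one side.
    locate : ∀ {D} → D ⊆ X₁ ∪ X₂ → Conn (Mono c) D → D ⊆ X₁ ⊎ D ⊆ X₂ ⊎ u ∈ D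
    locate {D} D⊆ conn with u ∈? D | D ⊆? X₂
    ... | yes u∈ | _       = inj₂ (inj₂ u∈)
    ... | no _   | yes D⊆₂ = inj₂ (inj₁ D⊆₂)
    ... | no u∉  | no D⊈₂ with ⊈⇒∃ D⊈₂
    ... | a , a∈ , a∉₂ = inj₁ λ b∈ → closed-star {P = _∈ X₁} stay (conn a∈ b∈)
      ([ id , (λ a∈₂ → contradiction a∈₂ a∉₂) ]′ (x∈p∪q⁻ X₁ X₂ (D⊆ a∈)))
      where
      stay : ∀ {p q} → p ∈ D → q ∈ D → Mono c p q → p ∈ X₁ → q ∈ X₁
      stay p∈D q∈D (e , _) p∈₁ with x∈p∪q⁻ X₁ X₂ (D⊆ q∈D)
      ... | inj₁ q∈₁ = q∈₁
      ... | inj₂ q∈₂ with sep p∈₁ q∈₂ e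
      ... | inj₁ refl = contradiction p∈D u∉
      ... | inj₂ refl = contradiction q∈D u∉

  -- A vertex u of W outside S either is superfluous or separates v from some
  -- vertex of S; in the latter case both sides together with u are smaller.
  steiner-rec : ∀ m W S v → ∣ W ∣ < m → Conn E W → S ⊆ W → v ∈ S →
    ∃[ X ] X ⊆ W × S ⊆ X × (∃[ c ] Good c X v ∣ S ∣)
  steiner-rec zero    W S v () conn S⊆ v∈S
  steiner-rec (suc m) W S v (s≤s ∣W∣≤m) conn S⊆ v∈S with W ⊆? S
  ... | yes W⊆ = W , id , S⊆ , let c , g = Good-spanning (S⊆ v∈S) conn in c , Good-mono (p⊆q⇒∣p∣≤∣q∣ W⊆) g
  ... | no W⊈ with ⊈⇒∃ W⊈
  ... | u , u∈W , u∉S with component (adj? G) (W - u) (x∈p∧x≢y⇒x∈p-y (S⊆ v∈S) λ { refl → u∉S v∈S }) (sym G)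
  ... | L₁ , conn₁ , v∈L₁ , L₁⊆ , closed with S ⊆? L₁
  ... | yes S⊆L₁ =
    let X , X⊆ , S⊆X , g = steiner-rec m L₁ S v (≤-trans (p⊂q⇒∣p∣<∣q∣ L₁⊂W) ∣W∣≤m) conn₁ S⊆L₁ v∈S
    in X , (λ x∈ → L₁⊆W (X⊆ x∈)) , S⊆X , g
    where
    L₁⊆W : L₁ ⊆ W
    L₁⊆W a∈ = proj₁ (x∈p─q⁻ (L₁⊆ a∈))
    L₁⊂W : L₁ ⊂ W
    L₁⊂W = L₁⊆W , u , u∈W , λ u∈L₁ → proj₂ (x∈p─q⁻ (L₁⊆ u∈L₁)) (x∈⁅x⁆ u)
  ... | no S⊈L₁ with ⊈⇒∃ S⊈L₁
  ... | s , s∈S , s∉L₁ = X₁ ∪ X₂ ,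
    (λ x∈ → [ (λ x∈₁ → W₁⊆ (X₁⊆ x∈₁)) , (λ x∈₂ → W₂⊆ (X₂⊆ x∈₂)) ]′ (x∈p∪q⁻ X₁ X₂ x∈)) ,
    S⊆X , Good-glue u∈X₁ u∈X₂ meet sep v∉X₂ (nonempty⇒1≤∣p∣ v∈S∩L₁) (nonempty⇒1≤∣p∣ s∈S∩L₂) count
      (Good-mono (∣p∪⁅x⁆∣≤ (S ∩ L₁) u) (proj₂ g₁)) (Good-mono (∣p∪⁅x⁆∣≤ (S ∩ L₂) u) (proj₂ g₂))
    where
    -- `L₂` collects all other components of `W - u`; with `u` added they form one connected set.
    L₂ = (W - u) ─ L₁
    W₁ = L₁ ∪ ⁅ u ⁆
    W₂ = L₂ ∪ ⁅ u ⁆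

    L₁⊆W : L₁ ⊆ W
    L₁⊆W a∈ = proj₁ (x∈p─q⁻ (L₁⊆ a∈))

    L₂⊆W : L₂ ⊆ W
    L₂⊆W a∈ = proj₁ (x∈p─q⁻ (proj₁ (x∈p─q⁻ a∈)))


    ∉L₁⇒∈W₂ : ∀ {a} → a ∈ W → a ∉ L₁ → a ∈ W₂
    ∉L₁⇒∈W₂ {a} a∈ a∉ with a ≟ u
    ... | yes refl = x∈p∪⁅x⁆
    ... | no a≢u   = p⊆p∪⁅x⁆ (x∈p∧x∉q⇒x∈p─q (x∈p∧x≢y⇒x∈p-y a∈ a≢u) a∉)

    W₁⊆ : W₁ ⊆ W
    W₁⊆ = p∪⁅x⁆⊆ L₁⊆W u∈W

    W₂⊆ : W₂ ⊆ W
    W₂⊆ = p∪⁅x⁆⊆ L₂⊆W u∈W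

    s∈L₂ : s ∈ L₂
    s∈L₂ = [ id , (λ { refl → contradiction s∈S u∉S }) ]′ (x∈p∪⁅y⁆⁻ (∉L₁⇒∈W₂ (S⊆ s∈S) s∉L₁))

    v∈S∩L₁ : v ∈ S ∩ L₁
    v∈S∩L₁ = x∈p∩q⁺ (v∈S , v∈L₁)

    s∈S∩L₂ : s ∈ S ∩ L₂
    s∈S∩L₂ = x∈p∩q⁺ (s∈S , s∈L₂)

    v∉W₂ : v ∉ W₂
    v∉W₂ v∈ = [ (λ v∈L₂ → proj₂ (x∈p─q⁻ v∈L₂) v∈L₁) , (λ { refl → u∉S v∈S }) ]′ (x∈p∪⁅y⁆⁻ v∈)

    s∉W₁ : s ∉ W₁
    s∉W₁ s∈ = [ s∉L₁ , (λ { refl → u∉S s∈S }) ]′ (x∈p∪⁅y⁆⁻ s∈)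

    W-meet : ∀ {a} → a ∈ W₁ → a ∈ W₂ → a ≡ u
    W-meet a∈₁ a∈₂ with x∈p∪⁅y⁆⁻ a∈₁ | x∈p∪⁅y⁆⁻ a∈₂
    ... | inj₂ a≡u | _        = a≡u
    ... | inj₁ _   | inj₂ a≡u = a≡u
    ... | inj₁ a∈L₁ | inj₁ a∈L₂ = contradiction a∈L₁ (proj₂ (x∈p─q⁻ a∈L₂))

    W-sep : ∀ {a b} → a ∈ W₁ → b ∈ W₂ → E a b → a ≡ u ⊎ b ≡ u
    W-sep a∈₁ b∈₂ e with x∈p∪⁅y⁆⁻ a∈₁ | x∈p∪⁅y⁆⁻ b∈₂
    ... | inj₂ a≡u | _        = inj₁ a≡u
    ... | inj₁ _   | inj₂ b≡u = inj₂ b≡u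
    ... | inj₁ a∈L₁ | inj₁ b∈L₂ = let b∈W-u , b∉L₁ = x∈p─q⁻ b∈L₂ in
      contradiction (closed a∈L₁ b∈W-u e) b∉L₁

    W⊆W₁∪W₂ : W ⊆ W₁ ∪ W₂
    W⊆W₁∪W₂ {a} a∈ with a ∈? L₁
    ... | yes a∈L₁ = x∈p∪q⁺ (inj₁ (p⊆p∪⁅x⁆ a∈L₁))
    ... | no a∉L₁  = x∈p∪q⁺ (inj₂ (∉L₁⇒∈W₂ a∈ a∉L₁))

    conn-W₁ : Conn E W₁
    conn-W₁ = subst (Conn E) (⊆-antisym (p∩q⊆q W W₁) λ a∈ → x∈p∩q⁺ (W₁⊆ a∈ , a∈))
      (Conn-part (sym G) W⊆W₁∪W₂ W-sep x∈p∪⁅x⁆ u∈W conn)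

    conn-W₂ : Conn E W₂
    conn-W₂ = subst (Conn E) (⊆-antisym (p∩q⊆q W W₂) λ a∈ → x∈p∩q⁺ (W₂⊆ a∈ , a∈))
      (Conn-part (sym G) (λ a∈ → x∈p∪q⁺ (Sum.swap (x∈p∪q⁻ W₁ W₂ (W⊆W₁∪W₂ a∈))))
        (λ a∈ b∈ e → Sum.swap (W-sep b∈ a∈ (sym G e))) x∈p∪⁅x⁆ u∈W conn)

    S∩⊆ : ∀ {L} → (S ∩ L) ∪ ⁅ u ⁆ ⊆ L ∪ ⁅ u ⁆
    S∩⊆ {L} = p∪⁅x⁆⊆ (λ a∈ → p⊆p∪⁅x⁆ (p∩q⊆q S L a∈)) x∈p∪⁅x⁆

    -- On both sides `u` becomes a terminal, and on the second it is the root, as `Good-glue` asks.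
    -- Both sets are smaller than `W`, since `W₁` misses `s` and `W₂` misses `v`.
    rec₁ = steiner-rec m W₁ ((S ∩ L₁) ∪ ⁅ u ⁆) v
      (≤-trans (p⊂q⇒∣p∣<∣q∣ (W₁⊆ , s , S⊆ s∈S , s∉W₁)) ∣W∣≤m) conn-W₁ S∩⊆ (p⊆p∪⁅x⁆ v∈S∩L₁)
    rec₂ = steiner-rec m W₂ ((S ∩ L₂) ∪ ⁅ u ⁆) u
      (≤-trans (p⊂q⇒∣p∣<∣q∣ (W₂⊆ , v , S⊆ v∈S , v∉W₂)) ∣W∣≤m) conn-W₂ S∩⊆ x∈p∪⁅x⁆

    X₁ = proj₁ rec₁
    X₂ = proj₁ rec₂

    X₁⊆ : X₁ ⊆ W₁
    X₁⊆ = proj₁ (proj₂ rec₁)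

    X₂⊆ : X₂ ⊆ W₂
    X₂⊆ = proj₁ (proj₂ rec₂)

    g₁ = proj₂ (proj₂ (proj₂ rec₁))
    g₂ = proj₂ (proj₂ (proj₂ rec₂))

    S₁⊆X₁ : (S ∩ L₁) ∪ ⁅ u ⁆ ⊆ X₁
    S₁⊆X₁ = proj₁ (proj₂ (proj₂ rec₁))

    S₂⊆X₂ : (S ∩ L₂) ∪ ⁅ u ⁆ ⊆ X₂
    S₂⊆X₂ = proj₁ (proj₂ (proj₂ rec₂))

    u∈X₁ : u ∈ X₁
    u∈X₁ = S₁⊆X₁ x∈p∪⁅x⁆

    u∈X₂ : u ∈ X₂
    u∈X₂ = S₂⊆X₂ x∈p∪⁅x⁆

    v∉X₂ : v ∉ X₂
    v∉X₂ v∈ = v∉W₂ (X₂⊆ v∈)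

    meet : ∀ {a} → a ∈ X₁ → a ∈ X₂ → a ≡ u
    meet a∈₁ a∈₂ = W-meet (X₁⊆ a∈₁) (X₂⊆ a∈₂)

    sep : ∀ {a b} → a ∈ X₁ → b ∈ X₂ → E a b → a ≡ u ⊎ b ≡ u
    sep a∈₁ b∈₂ = W-sep (X₁⊆ a∈₁) (X₂⊆ b∈₂)

    S⊆X : S ⊆ X₁ ∪ X₂
    S⊆X {a} a∈ with a ∈? L₁
    ... | yes a∈L₁ = x∈p∪q⁺ (inj₁ (S₁⊆X₁ (p⊆p∪⁅x⁆ (x∈p∩q⁺ (a∈ , a∈L₁)))))
    ... | no a∉L₁ with x∈p∪⁅y⁆⁻ (∉L₁⇒∈W₂ (S⊆ a∈) a∉L₁)
    ... | inj₁ a∈L₂ = x∈p∪q⁺ (inj₂ (S₂⊆X₂ (p⊆p∪⁅x⁆ (x∈p∩q⁺ (a∈ , a∈L₂)))))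
    ... | inj₂ refl = contradiction a∈ u∉S

    count : ∣ S ∩ L₁ ∣ + ∣ S ∩ L₂ ∣ ≤ ∣ S ∣
    count = begin
      ∣ S ∩ L₁ ∣ + ∣ S ∩ L₂ ∣                                   ≡⟨ ∣p∪q∣+∣p∩q∣ (S ∩ L₁) (S ∩ L₂) ⟨
      ∣ S ∩ L₁ ∪ S ∩ L₂ ∣ + ∣ (S ∩ L₁) ∩ (S ∩ L₂) ∣             ≤⟨ ℕ.+-mono-≤ (p⊆q⇒∣p∣≤∣q∣ ∪⊆S) (≤-reflexive ∩-empty) ⟩
      ∣ S ∣ + 0                                                 ≡⟨ ℕ.+-identityʳ _ ⟩
      ∣ S ∣                                                     ∎
      where
      open ℕ.≤-Reasoning
      ∪⊆S : S ∩ L₁ ∪ S ∩ L₂ ⊆ S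
      ∪⊆S a∈ = [ p∩q⊆p S L₁ , p∩q⊆p S L₂ ]′ (x∈p∪q⁻ _ _ a∈)
      ∩-empty : ∣ (S ∩ L₁) ∩ (S ∩ L₂) ∣ ≡ 0
      ∩-empty = trans (cong ∣_∣ (Empty-unique λ (a , a∈) →
        let a∈₁ , a∈₂ = x∈p∩q⁻ (S ∩ L₁) (S ∩ L₂) a∈ in
        proj₂ (x∈p─q⁻ (p∩q⊆q S L₂ a∈₂)) (p∩q⊆q S L₁ a∈₁))) (∣⊥∣≡0 n)

  abstract
    Good-steiner : ∀ {W S v} → Conn E W → S ⊆ W → v ∈ S →
      ∃[ X ] X ⊆ W × S ⊆ X × (∃[ c ] Good c X v ∣ S ∣)
    Good-steiner {W} {S} {v} = steiner-rec (suc ∣ W ∣) W S v (ℕ.n<1+n ∣ W ∣)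

  -- A vertex seeing only one colour is added in the other one, where it has no neighbour.
  abstract
    saturate : ∀ {X C c m} → X ⊆ C → Nonempty X → Conn (Cross c) X → 1 ≤ m →
      (∀ {D} → D ⊆ X → Conn (Mono c) D → ∣ D ∣ ≤ m) →
      ∃[ Y ] X ⊆ Y × Y ⊆ C × (∃[ c′ ] Conn (Cross c′) Y ×
        (∀ {D} → D ⊆ Y → Conn (Mono c′) D → ∣ D ∣ ≤ m) ×
        (∀ {v u} → v ∈ C → v ∉ Y → u ∈ Y → E v u → ∀ β → ∃[ a ] a ∈ Y × E v a × c′ a ≡ β))
    saturate {X} {C} {c} {m} X⊆C (x₀ , x₀∈) conn 1≤m bound =
      climb {Q = Q} step X (id , X⊆C , c , conn , bound)
      where
      Q : Subset n → Set
      Q Y = X ⊆ Y × Y ⊆ C × (∃[ c′ ] Conn (Cross c′) Y × (∀ {D} → D ⊆ Y → Conn (Mono c′) D → ∣ D ∣ ≤ m))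

      Done : Set
      Done = ∃[ Y ] X ⊆ Y × Y ⊆ C × (∃[ c′ ] Conn (Cross c′) Y ×
        (∀ {D} → D ⊆ Y → Conn (Mono c′) D → ∣ D ∣ ≤ m) ×
        (∀ {v u} → v ∈ C → v ∉ Y → u ∈ Y → E v u → ∀ β → ∃[ a ] a ∈ Y × E v a × c′ a ≡ β))

      step : ∀ Y → Q Y → Done ⊎ (∃[ x ] x ∉ Y × Q (Y ∪ ⁅ x ⁆))
      step Y (X⊆ , Y⊆ , c′ , conn′ , bound′) = go (any? λ v → any? λ u →
        (v ∈? C) ×-dec ¬? (v ∈? Y) ×-dec (u ∈? Y) ×-dec adj? G v u ×-dec
        ((¬? (sees? v true)) ⊎-dec (¬? (sees? v false))))
        where
        Sees : Fin n → Bool → Set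
        Sees v β = ∃[ a ] a ∈ Y × E v a × c′ a ≡ β

        sees? : ∀ v β → Dec (Sees v β)
        sees? v β = any? λ a → (a ∈? Y) ×-dec adj? G v a ×-dec (c′ a Bool.≟ β)

        add : ∀ {v u} → v ∈ C → v ∉ Y → u ∈ Y → E v u → ∀ β → ¬ Sees v β → Q (Y ∪ ⁅ v ⁆)
        add {v} {u} v∈ v∉ u∈ e β ¬sees = (λ a∈ → p⊆p∪⁅x⁆ (X⊆ a∈)) , p∪⁅x⁆⊆ Y⊆ v∈ , painted ,
          -- `v` sees no vertex of colour `β`, so `u` has the other colour and its edge to `v`
          -- crosses.
          painted-crossing conn′ u∈ (sym G e) (λ eq → ¬sees (u , u∈ , e , eq)) , λ {D} D⊆ conn-D → bound″ D⊆ conn-D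
          where
          open Paint {c′} v∉ β
          bound″ : ∀ {D} → D ⊆ Y ∪ ⁅ v ⁆ → Conn (Mono painted) D → ∣ D ∣ ≤ m
          bound″ {D} D⊆ conn-D with v ∈? D
          ... | no v∉D  = bound′ (avoids D⊆ v∉D) (painted-mono (avoids D⊆ v∉D) conn-D)
          ... | yes v∈D with 2 ≤? ∣ cluster ∣
          ... | yes 2≤ = let w , w∈ , e′ , cw = cluster-nbr 2≤ in contradiction (w , w∈ , sym G e′ , cw) ¬sees
          -- The cluster of `v` is `v` alone, of size `1 ≤ m`.
          ... | no ≱2  = ≤-trans (p⊆q⇒∣p∣≤∣q∣ (⊆cluster D⊆ v∈D conn-D)) (≤-trans (ℕ.≤-pred (ℕ.≰⇒> ≱2)) 1≤m)

        go : Dec (∃[ v ] ∃[ u ] v ∈ C × v ∉ Y × u ∈ Y × E v u × (¬ Sees v true ⊎ ¬ Sees v false)) →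
          Done ⊎ (∃[ x ] x ∉ Y × Q (Y ∪ ⁅ x ⁆))
        go (yes (v , u , v∈ , v∉ , u∈ , e , inj₁ ¬s)) = inj₂ (v , v∉ , add v∈ v∉ u∈ e true ¬s)
        go (yes (v , u , v∈ , v∉ , u∈ , e , inj₂ ¬s)) = inj₂ (v , v∉ , add v∈ v∉ u∈ e false ¬s)
        go (no ¬w) = inj₁ (Y , X⊆ , Y⊆ , c′ , conn′ , bound′ , λ {v} {u} v∈ v∉ u∈ e → λ where
          true  → decidable-stable (sees? v true) λ ¬s → ¬w (v , u , v∈ , v∉ , u∈ , e , inj₁ ¬s)
          false → decidable-stable (sees? v false) λ ¬s → ¬w (v , u , v∈ , v∉ , u∈ , e , inj₂ ¬s))

-- Unions of families, and spanning trees given by parent maps.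

∈-⋃⁺ : ∀ {m} (S : Fin m → Subset n) {s x} → x ∈ S s → x ∈ ⋃ (tabulate S)
∈-⋃⁺ S {zero}  x∈ = x∈p∪q⁺ (inj₁ x∈)
∈-⋃⁺ S {suc s} x∈ = x∈p∪q⁺ (inj₂ (∈-⋃⁺ (S ∘ suc) x∈))

∈-⋃⁻ : ∀ {m} (S : Fin m → Subset n) {x} → x ∈ ⋃ (tabulate S) → ∃[ s ] x ∈ S s
∈-⋃⁻ {m = zero}  S x∈ = contradiction x∈ ∉⊥
∈-⋃⁻ {m = suc m} S x∈ with x∈p∪q⁻ _ _ x∈
... | inj₁ x∈₀ = zero , x∈₀
... | inj₂ x∈₁ = let s , x∈s = ∈-⋃⁻ (S ∘ suc) x∈₁ in suc s , x∈s

module SpanningTree {R : Fin n → Fin n → Set} (R? : Decidable R) (R-sym : Symmetric R)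
  {W : Subset n} {r : Fin n} (r∈W : r ∈ W) (conn : Conn R W) where

  private
    -- A tree on `U` as a parent map `p` with a rank that drops towards the root `r`. All ranks in
    -- use are below `b`, so `b` is free for the next vertex. The values of `p` at `r` and outside
    -- `U` are arbitrary.
    Rooted : Subset n → Set
    Rooted U = Σ[ p ∈ (Fin n → Fin n) ] Σ[ rank ∈ (Fin n → ℕ) ] Σ[ b ∈ ℕ ]
      (∀ {v} → v ∈ U → rank v < b) ×
      (∀ {v} → v ∈ U → v ≢ r → p v ∈ U × R (p v) v × rank (p v) < rank v)

    rooted-extend : ∀ {U x y} → Rooted U → y ∈ U → x ∉ U → R y x → Rooted (U ∪ ⁅ x ⁆)
    rooted-extend {U} {x} {y} (p , rank , b , rank<b , parent) y∈ x∉ e =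
      p′ , rank′ , suc b , rank′<b , parent′
      where
      p′ : Fin n → Fin n
      p′ = updateAt p x (const y)

      rank′ : Fin n → ℕ
      rank′ = updateAt rank x (const b)

      rank-old : ∀ {v} → v ∈ U → rank′ v ≡ rank v
      rank-old {v} v∈ = updateAt-minimal v x rank λ { refl → x∉ v∈ }

      rank′<b : ∀ {v} → v ∈ U ∪ ⁅ x ⁆ → rank′ v < suc b
      rank′<b v∈ with x∈p∪⁅y⁆⁻ v∈
      ... | inj₁ v∈U  = subst (_< suc b) (≡.sym (rank-old v∈U)) (ℕ.m<n⇒m<1+n (rank<b v∈U))
      ... | inj₂ refl = s≤s (≤-reflexive (updateAt-updates x rank))

      parent′ : ∀ {v} → v ∈ U ∪ ⁅ x ⁆ → v ≢ r →
        p′ v ∈ U ∪ ⁅ x ⁆ × R (p′ v) v × rank′ (p′ v) < rank′ v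
      parent′ {v} v∈ v≢r with x∈p∪⁅y⁆⁻ v∈
      ... | inj₁ v∈U rewrite updateAt-minimal v x {const y} p (λ { refl → x∉ v∈U }) =
        let pv∈ , pe , lt = parent v∈U v≢r in
        p⊆p∪⁅x⁆ pv∈ , pe , ≡.subst₂ _<_ (≡.sym (rank-old pv∈)) (≡.sym (rank-old v∈U)) lt
      ... | inj₂ refl rewrite updateAt-updates x {const y} p =
        p⊆p∪⁅x⁆ y∈ , e , ≡.subst₂ _<_ (≡.sym (rank-old y∈)) (≡.sym (updateAt-updates x rank)) (rank<b y∈)

    abstract
      rooted : Rooted W
      rooted = grow-all R? W r∈W Rooted
        (id , const 0 , 1 , (λ _ → s≤s z≤n) , λ v∈ v≢r → contradiction (x∈⁅y⁆⇒x≡y r v∈) v≢r)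
        (λ _ _ rt y∈ _ x∉ → rooted-extend rt y∈ x∉) conn

    p = proj₁ rooted
    rank = proj₁ (proj₂ rooted)

    parent : ∀ {v} → v ∈ W → v ≢ r → p v ∈ W × R (p v) v × rank (p v) < rank v
    parent = proj₂ (proj₂ (proj₂ (proj₂ rooted)))

    Par : Fin n → Fin n → Set
    Par u v = v ∈ W × v ≢ r × p v ≡ u

    par? : Decidable Par
    par? u v = (v ∈? W) ×-dec ¬? (v ≟ r) ×-dec (p v ≟ u)

    par-∈ : ∀ {u v} → Par u v → u ∈ W
    par-∈ (v∈ , v≢r , refl) = proj₁ (parent v∈ v≢r)

    par-R : ∀ {u v} → Par u v → R u v
    par-R (v∈ , v≢r , refl) = proj₁ (proj₂ (parent v∈ v≢r))

    par-< : ∀ {u v} → Par u v → rank u < rank v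
    par-< (v∈ , v≢r , refl) = proj₂ (proj₂ (parent v∈ v≢r))

    par-unique : ∀ {u u′ v} → Par u v → Par u′ v → u ≡ u′
    par-unique (_ , _ , eq) (_ , _ , eq′) = trans (≡.sym eq) eq′

  spanning : Graph n
  spanning = record
    { V      = W
    ; Adj    = λ u v → Par u v ⊎ Par v u
    ; adj?   = λ u v → par? u v ⊎-dec par? v u
    ; sym    = Sum.swap
    ; irrefl = [ (λ e → ℕ.<-irrefl refl (par-< e)) , (λ e → ℕ.<-irrefl refl (par-< e)) ]′
    ; inV    = [ par-∈ , proj₁ ]′
    }

  spanning⇒R : ∀ {u v} → Adj spanning u v → R u v
  spanning⇒R = [ par-R , (λ e → R-sym (par-R e)) ]′

  private
    to-root : ∀ m {v} → rank v < m → v ∈ W → Star (Adj spanning) v r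
    to-root (suc m) {v} (s≤s lt) v∈ with v ≟ r
    ... | yes refl = ε
    ... | no v≢r   = let pv∈ , _ , pv< = parent v∈ v≢r in
      inj₂ (v∈ , v≢r , refl) ◅ to-root m (≤-trans pv< lt) pv∈

    NoBacktrack : List (Fin n) → Set
    NoBacktrack (a ∷ b ∷ c ∷ l) = a ≢ c × NoBacktrack (b ∷ c ∷ l)
    NoBacktrack _               = ⊤

    noBacktrack-tail : ∀ a l → NoBacktrack (a ∷ l) → NoBacktrack l
    noBacktrack-tail a []          _        = tt
    noBacktrack-tail a (_ ∷ [])    _        = tt
    noBacktrack-tail a (_ ∷ _ ∷ _) (_ , nb) = nb

    unique⇒noBacktrack : ∀ {e} a zs → All (_≢ e) (a ∷ zs) → Unique (a ∷ zs) → NoBacktrack (a ∷ zs ∷ʳ e)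
    unique⇒noBacktrack a []            _            _                       = tt
    unique⇒noBacktrack a (_ ∷ [])      (a≢e ∷ _)    _                       = a≢e , tt
    unique⇒noBacktrack a (b ∷ c ∷ zs) (_ ∷ ≢e) ((_ ∷ a≢c ∷ _) ∷ uniq) = a≢c , unique⇒noBacktrack b (c ∷ zs) ≢e uniq

    penultimate : Fin n → List (Fin n) → Fin n
    penultimate a []       = a
    penultimate a (z ∷ zs) = penultimate z zs

    -- Parents are unique, so a walk that has gone up in rank cannot turn back.
    ascend : ∀ {a b e} zs → Par a b → Linked (Adj spanning) (b ∷ zs ∷ʳ e) → NoBacktrack (a ∷ b ∷ zs ∷ʳ e) →
      rank a < rank e × Par (penultimate b zs) e
    ascend []       ab (inj₁ be ∷ _)    nb        = ℕ.<-trans (par-< ab) (par-< be) , be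
    ascend []       ab (inj₂ eb ∷ _)    (a≢e , _) = contradiction (par-unique ab eb) a≢e
    ascend (z ∷ zs) ab (inj₁ bz ∷ link) (_ , nb)  =
      let lt , last = ascend zs bz link nb in ℕ.<-trans (par-< ab) lt , last
    ascend (z ∷ zs) ab (inj₂ zb ∷ _)    (a≢z , _) = contradiction (par-unique ab zb) a≢z

    -- A walk that never turns back first goes down towards the root and, once it has gone up, only
    -- goes up. So it either ends below its start or enters `e` from the parent of `e`.
    descend : ∀ {e} a zs → Linked (Adj spanning) (a ∷ zs ∷ʳ e) → NoBacktrack (a ∷ zs ∷ʳ e) →
      rank e < rank a ⊎ Par (penultimate a zs) e
    descend a []       (inj₁ ae ∷ _)    nb = inj₂ ae
    descend a []       (inj₂ ea ∷ _)    nb = inj₁ (par-< ea)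
    descend a (z ∷ zs) (inj₁ az ∷ link) nb = inj₂ (proj₂ (ascend zs az link nb))
    descend a (z ∷ zs) (inj₂ za ∷ link) nb =
      Sum.map (λ lt → ℕ.<-trans lt (par-< za)) id (descend z zs link (noBacktrack-tail a _ nb))

    penultimate-≢ : ∀ {y} z zs → All (y ≢_) (z ∷ zs) → penultimate z zs ≢ y
    penultimate-≢ z []        (y≢z ∷ _) eq = y≢z (≡.sym eq)
    penultimate-≢ z (z′ ∷ zs) (_ ∷ ≢s)     = penultimate-≢ z′ zs ≢s

    -- If the cycle starts upwards, it rises all the way and `x` outranks itself. If it starts down
    -- to the parent `y` of `x`, it must return to `x` from that same parent, but its last vertex
    -- before `x` is not `y`.
    acyclic : ∀ x ys → ¬ IsCycle spanning x ys
    acyclic x (_ ∷ []) (s≤s () , _)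
    acyclic x (y ∷ z ∷ zs) (_ , (x≢y ∷ x≢z ∷ x≢zs) ∷ y≢ ∷ uniq , edge ∷ link) = go edge
      where
      nb : NoBacktrack (y ∷ z ∷ zs ∷ʳ x)
      nb = unique⇒noBacktrack y (z ∷ zs) (All.map (λ ne eq → ne (≡.sym eq)) (x≢y ∷ x≢z ∷ x≢zs)) (y≢ ∷ uniq)

      go : ¬ Adj spanning x y
      go (inj₁ xy) = ℕ.<-irrefl refl (proj₁ (ascend (z ∷ zs) xy link (x≢z , nb)))
      go (inj₂ yx) with descend y (z ∷ zs) link nb
      ... | inj₁ lt   = ℕ.<-asym lt (par-< yx)
      ... | inj₂ last = penultimate-≢ z zs y≢ (par-unique last yx)

  spanning-isTree : IsTree spanning
  spanning-isTree = ((r , r∈W) , λ u∈ v∈ → to-root _ ≤-refl u∈ ◅◅ Star.reverse Sum.swap (to-root _ ≤-refl v∈)) , acyclic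

-- Odd expansions from disjoint coloured sets with monochromatic links.

module OddMinor (G : Graph n) {t : ℕ}
  (W : Fin t → Subset n) (c : Fin t → Fin n → Bool)
  (W⊆V : ∀ s → W s ⊆ V G)
  (nonempty : ∀ s → Nonempty (W s))
  (conn : ∀ s → Conn (Colouring.Cross G (c s)) (W s))
  (disj : ∀ {s s′ x} → x ∈ W s → x ∈ W s′ → s ≡ s′)
  (link : ∀ s s′ → s ≢ s′ → ∃[ u ] ∃[ v ] u ∈ W s × v ∈ W s′ × Adj G u v × c s u ≡ c s′ v)
  where

  open Colouring G

  private
    module T (s : Fin t) = SpanningTree (cross? (c s)) (cross-sym (c s)) (proj₂ (nonempty s)) (conn s)

    -- Junk value on the diagonal.
    edge : Fin t → Fin t → Fin n × Fin n
    edge s s′ with s ≟ s′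
    ... | yes _ = proj₁ (nonempty s) , proj₁ (nonempty s)
    ... | no ne = let u , v , _ = link s s′ ne in u , v

    edge-link : ∀ {s s′ u v} → s ≢ s′ → (u , v) ≡ edge s s′ → u ∈ W s × v ∈ W s′ × E u v × c s u ≡ c s′ v
    edge-link {s} {s′} ne eq with s ≟ s′ | eq
    ... | yes eq′ | _    = contradiction eq′ ne
    ... | no ne′  | refl = proj₂ (proj₂ (link s s′ ne′))

    <⇒≢ : ∀ {s s′ : Fin t} → s <ᶠ s′ → s ≢ s′
    <⇒≢ lt refl = ℕ.<-irrefl refl lt

    -- `edge s s′` and `edge s′ s` may be different edges of `G`, so only the one with `s` below
    -- `s′` is kept, in both orientations. This gives exactly one edge per pair of trees.
    Link : Fin n → Fin n → Set
    Link u v = ∃[ s ] ∃[ s′ ] s <ᶠ s′ × ((u , v) ≡ edge s s′ ⊎ (v , u) ≡ edge s s′)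

    InTree : Fin n → Fin n → Set
    InTree u v = ∃[ s ] Adj (T.spanning s) u v

    ≟² : (x y : Fin n × Fin n) → Dec (x ≡ y)
    ≟² = ≡-dec _≟_ _≟_

    link? : Decidable Link
    link? u v = any? λ s → any? λ s′ → (s <ᶠ? s′) ×-dec (≟² (u , v) (edge s s′) ⊎-dec ≟² (v , u) (edge s s′))

    link-sides : ∀ {u v} → Link u v → ∃[ s ] ∃[ s′ ] s ≢ s′ × u ∈ W s × v ∈ W s′ × E u v × c s u ≡ c s′ v
    link-sides (s , s′ , lt , inj₁ eq) = s , s′ , <⇒≢ lt , edge-link (<⇒≢ lt) eq
    link-sides (s , s′ , lt , inj₂ eq) =
      let v∈ , u∈ , e , same = edge-link (<⇒≢ lt) eq in
      s′ , s , <⇒≢ lt ∘ ≡.sym , u∈ , v∈ , sym G e , ≡.sym same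

    F : Graph n
    F = record
      { V      = ⋃ (tabulate W)
      ; Adj    = λ u v → InTree u v ⊎ Link u v
      ; adj?   = λ u v → any? (λ s → adj? (T.spanning s) u v) ⊎-dec link? u v
      ; sym    = Sum.map (λ (s , e) → s , sym (T.spanning s) e)
                         (λ (s , s′ , lt , eq) → s , s′ , lt , Sum.swap eq)
      ; irrefl = [ (λ (s , e) → irrefl (T.spanning s) e)
                 , (λ l → let _ , _ , ne , u∈ , u∈′ , _ = link-sides l in ne (disj u∈ u∈′)) ]′
      ; inV    = [ (λ (s , e) → ∈-⋃⁺ W (inV (T.spanning s) e))
                 , (λ l → let _ , _ , _ , u∈ , _ = link-sides l in ∈-⋃⁺ W u∈) ]′
      }

    F⊆G : F ⊆ᴳ G
    F⊆G = (λ x∈ → let s , x∈s = ∈-⋃⁻ W x∈ in W⊆V s x∈s) ,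
      [ (λ (s , e) → proj₁ (T.spanning⇒R s e)) , (λ l → let _ , _ , _ , _ , _ , e , _ = link-sides l in e) ]′

    between : ∀ {s s′ u v} → s ≢ s′ → u ∈ W s → v ∈ W s′ → Adj F u v →
      (s <ᶠ s′ × (u , v) ≡ edge s s′) ⊎ (s′ <ᶠ s × (v , u) ≡ edge s′ s)
    between ne u∈ v∈ (inj₁ (s , e)) = contradiction
      (trans (disj u∈ (inV (T.spanning s) e)) (disj (inV (T.spanning s) (sym (T.spanning s) e)) v∈)) ne
    between ne u∈ v∈ (inj₂ (a , b , lt , inj₁ eq)) with edge-link (<⇒≢ lt) eq
    ... | u∈′ , v∈′ , _ with disj u∈ u∈′ | disj v∈ v∈′
    ... | refl | refl = inj₁ (lt , eq)
    between ne u∈ v∈ (inj₂ (a , b , lt , inj₂ eq)) with edge-link (<⇒≢ lt) eq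
    ... | v∈′ , u∈′ , _ with disj u∈ u∈′ | disj v∈ v∈′
    ... | refl | refl = inj₂ (lt , eq)

    joining-cmp : ∀ {s s′} → s ≢ s′ → Tri (s <ᶠ s′) (s ≡ s′) (s′ <ᶠ s) →
      ∃! _≡_ λ ((u , v) : Fin n × Fin n) → u ∈ W s × v ∈ W s′ × Adj F u v
    joining-cmp ne (tri≈ _ eq _) = contradiction eq ne
    joining-cmp {s} {s′} ne (tri< lt _ ¬gt) = edge s s′ ,
      (let u∈ , v∈ , _ = edge-link ne refl in u∈ , v∈ , inj₂ (s , s′ , lt , inj₁ refl)) ,
      λ (u∈ , v∈ , e) →
        [ (λ (_ , eq) → ≡.sym eq) , (λ (gt , _) → contradiction gt ¬gt) ]′ (between ne u∈ v∈ e)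
    joining-cmp {s} {s′} ne (tri> ¬lt _ gt) = swap (edge s′ s) ,
      (let v∈ , u∈ , _ = edge-link (ne ∘ ≡.sym) refl in u∈ , v∈ , inj₂ (s′ , s , gt , inj₂ refl)) ,
      λ (u∈ , v∈ , e) →
        [ (λ (lt , _) → contradiction lt ¬lt) , (λ (_ , eq) → ≡.sym (cong swap eq)) ]′ (between ne u∈ v∈ e)

    expansion : Expansion t F
    expansion = record
      { tree     = T.spanning
      ; isTree   = T.spanning-isTree
      ; disjoint = λ ne (_ , x∈) → let x∈₁ , x∈₂ = x∈p∩q⁻ _ _ x∈ in ne (disj x∈₁ x∈₂)
      ; vertices = refl
      ; induced  = λ s → ((λ x∈ → ∈-⋃⁺ W x∈) , λ e → inj₁ (s , e)) , λ u∈ v∈ → λ where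
          (inj₁ (s′ , e)) → case disj u∈ (inV (T.spanning s′) e) of λ { refl → e }
          (inj₂ l) → let _ , _ , ne , u∈′ , v∈′ , _ = link-sides l in
            contradiction (trans (disj u∈′ u∈) (disj v∈ v∈′)) ne
      ; joining  = λ ne → joining-cmp ne (<-cmp _ _)
      }

    -- Disjointness makes the set found by the search unique; `false` is a default outside all sets.
    colour : Fin n → Bool
    colour u with any? (λ s → u ∈? W s)
    ... | yes (s , _) = c s u
    ... | no _        = false

    colour-≡ : ∀ {s u} → u ∈ W s → colour u ≡ c s u
    colour-≡ {s} {u} u∈ with any? (λ s → u ∈? W s)
    ... | yes (s′ , u∈′) = cong (λ s → c s u) (disj u∈′ u∈)
    ... | no ¬u∈         = contradiction (s , u∈) ¬u∈

  abstract
    hasOddMinor : HasOddMinor t G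
    hasOddMinor = F , F⊆G , expansion , colour ,
      (λ s e eq → proj₂ (T.spanning⇒R s e) (trans (≡.sym (colour-≡ (inV (T.spanning s) e)))
        (trans eq (colour-≡ (inV (T.spanning s) (sym (T.spanning s) e)))))) ,
      λ ne u∈ v∈ e → trans (colour-≡ u∈) (trans
        ([ (λ (_ , eq) → proj₂ (proj₂ (proj₂ (edge-link ne eq))))
         , (λ (_ , eq) → ≡.sym (proj₂ (proj₂ (proj₂ (edge-link (ne ∘ ≡.sym) eq))))) ]′ (between ne u∈ v∈ e))
        (≡.sym (colour-≡ v∈)))

-- Choice of indices and of terminals; reversal of the index order.

injection-into : ∀ {ℓ} (J : Subset ℓ) m → m ≤ ∣ J ∣ →
  Σ[ g ∈ (Fin m → Fin ℓ) ] (∀ {r s} → g r ≡ g s → r ≡ s) × (∀ s → g s ∈ J)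
injection-into J             zero    _ = (λ ()) , (λ { {()} }) , λ ()
injection-into []            (suc m) ()
injection-into (outside ∷ J) (suc m) m≤ =
  let g , inj , g∈ = injection-into J (suc m) m≤ in
  suc ∘ g , inj ∘ suc-injective , Vec.there ∘ g∈
injection-into {suc ℓ} (inside ∷ J) (suc m) (s≤s m≤) with injection-into J m m≤
... | g , inj , g∈ = g′ , inj′ , g′∈
  where
  g′ : Fin (suc m) → Fin (suc ℓ)
  g′ zero    = zero
  g′ (suc s) = suc (g s)

  inj′ : ∀ {r s} → g′ r ≡ g′ s → r ≡ s
  inj′ {zero}  {zero}  _  = refl
  inj′ {suc r} {suc s} eq = cong suc (inj (suc-injective eq))

  g′∈ : ∀ s → g′ s ∈ inside ∷ J
  g′∈ zero    = Vec.here
  g′∈ (suc s) = Vec.there (g∈ s)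

-- One vertex is chosen per index of `J`; indices may share a vertex, so `S` can be smaller than
-- `J`.
representatives : ∀ {ℓ} (J : Subset ℓ) {C : Subset n} {P : Fin ℓ → Fin n → Set} →
  (∀ {j} → j ∈ J → ∃[ x ] x ∈ C × P j x) →
  ∃[ S ] S ⊆ C × ∣ S ∣ ≤ ∣ J ∣ × (∀ {j} → j ∈ J → ∃[ x ] x ∈ S × P j x)
representatives {n} [] _ = ∅ , (λ x∈ → contradiction x∈ ∉⊥) , ≤-reflexive (∣⊥∣≡0 n) , λ ()
representatives (outside ∷ J) {P = P} rep =
  let S , S⊆ , size , rep′ = representatives J {P = λ j → P (suc j)} (λ j∈ → rep (Vec.there j∈)) in
  S , S⊆ , size , λ { (Vec.there j∈) → rep′ j∈ }
representatives (inside ∷ J) {P = P} rep =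
  let S , S⊆ , size , rep′ = representatives J {P = λ j → P (suc j)} (λ j∈ → rep (Vec.there j∈))
      x , x∈ , px = rep Vec.here in
  S ∪ ⁅ x ⁆ , p∪⁅x⁆⊆ S⊆ x∈ , ≤-trans (∣p∪⁅x⁆∣≤ S x) (s≤s size) , λ where
    Vec.here       → x , x∈p∪⁅x⁆ , px
    (Vec.there j∈) → let y , y∈ , py = rep′ j∈ in y , p⊆p∪⁅x⁆ y∈ , py

∈-unionUpTo : ∀ {ℓ} (H : Fin ℓ → Graph n) {i j x} → j ≤ᶠ i → x ∈ V (H j) → x ∈ unionUpTo H i
∈-unionUpTo H {i}     {zero}  j≤i       x∈ = x∈p∪q⁺ (inj₁ x∈)
∈-unionUpTo H {suc i} {suc j} (s≤s j≤i) x∈ = x∈p∪q⁺ (inj₂ (∈-unionUpTo (H ∘ suc) j≤i x∈))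

opposite-anti-≤ : ∀ {ℓ} {i j : Fin ℓ} → i ≤ᶠ j → opposite j ≤ᶠ opposite i
opposite-anti-≤ {ℓ} {i} {j} i≤j = ≡.subst₂ _≤_ (≡.sym (opposite-prop j)) (≡.sym (opposite-prop i))
  (ℕ.∸-monoʳ-≤ ℓ (s≤s i≤j))

opposite-injective : ∀ {ℓ} {i j : Fin ℓ} → opposite i ≡ opposite j → i ≡ j
opposite-injective {i = i} {j} eq =
  trans (≡.sym (opposite-involutive i)) (trans (cong opposite eq) (opposite-involutive j))

-- Chains of parts and their extension.

record Part (n : ℕ) : Set where
  constructor part
  field
    set    : Subset n
    colour : Fin n → Bool
open Part

-- The excluded order is written `3 + t₀`, so that `t - 2` becomes `suc t₀`.
module Decomposition (G : Graph n) (t₀ : ℕ) (noMinor : ¬ HasOddMinor (3 + t₀) G) where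

  open Colouring G

  Touches : Subset n → Subset n → Set
  Touches X Y = ∃[ u ] ∃[ v ] u ∈ X × v ∈ Y × E u v

  touches? : ∀ X Y → Dec (Touches X Y)
  touches? X Y = any? λ u → any? λ v → (u ∈? X) ×-dec (v ∈? Y) ×-dec adj? G u v

  -- The parts are listed from the last one to the first, so the parts up to
  -- a given one are those from its index onwards.
  AvoidsFrom : ∀ {ℓ} → ℕ → (Fin ℓ → Part n) → Fin n → Set
  AvoidsFrom m f x = ∀ j → m ≤ toℕ j → x ∉ set (f j)

  -- `sees` and `clique` speak about every stage of the removal at once: stage `m` involves only the
  -- indices from `m` onwards. A new part takes index zero and shifts the others, so the earlier
  -- stages carry over unchanged.
  record Chain {ℓ : ℕ} (f : Fin ℓ → Part n) : Set where
    field
      within   : ∀ k → set (f k) ⊆ V G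
      nonempty : ∀ k → Nonempty (set (f k))
      crosses  : ∀ k → Conn (Cross (colour (f k))) (set (f k))
      small    : ∀ k {D} → D ⊆ set (f k) → Conn (Mono (colour (f k))) D → ∣ D ∣ ≤ ⌈ suc t₀ /2⌉
      disj     : ∀ {j k x} → x ∈ set (f j) → x ∈ set (f k) → j ≡ k
      sees     : ∀ k {v u} → v ∈ V G → AvoidsFrom (toℕ k) f v → u ∈ set (f k) → E v u →
                 ∀ β → ∃[ a ] a ∈ set (f k) × E v a × colour (f k) a ≡ β
      clique   : ∀ m {C} → C ⊆ V G → Conn E C → (∀ {x} → x ∈ C → AvoidsFrom m f x) →
                 ∀ {j k} → m ≤ toℕ j → m ≤ toℕ k → j ≢ k →
                 Touches (set (f j)) C → Touches (set (f k)) C → Touches (set (f j)) (set (f k))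

  Touches-sym : ∀ {X Y} → Touches X Y → Touches Y X
  Touches-sym (u , v , u∈ , v∈ , e) = v , u , v∈ , u∈ , sym G e

  module _ {ℓ : ℕ} {f : Fin ℓ → Part n} (chain : Chain f) where
    open Chain chain

    Linked-parts : (P Q : Part n) → Set
    Linked-parts P Q = ∃[ u ] ∃[ v ] u ∈ set P × v ∈ set Q × E u v × colour P u ≡ colour Q v

    Linked-sym : ∀ {P Q} → Linked-parts P Q → Linked-parts Q P
    Linked-sym (u , v , u∈ , v∈ , e , eq) = v , u , v∈ , u∈ , sym G e , ≡.sym eq

    -- The part with the larger index was removed first. A vertex of the other part next to it sees
    -- both colours in it, in particular its own.
    touching-parts-linked : ∀ {j k} → j ≢ k → Touches (set (f j)) (set (f k)) → Linked-parts (f j) (f k)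
    touching-parts-linked {j} {k} ne (u , v , u∈ , v∈ , e) with ℕ.≤-total (toℕ j) (toℕ k)
    ... | inj₁ j≤k =
      let a , a∈ , e′ , eq = sees k (within j u∈) avoid v∈ e (colour (f j) u) in
      u , a , u∈ , a∈ , e′ , ≡.sym eq
      where
      avoid : AvoidsFrom (toℕ k) f u
      avoid i k≤i u∈i with disj u∈ u∈i
      ... | refl = ne (toℕ-injective (ℕ.≤-antisym j≤k k≤i))
    ... | inj₂ k≤j =
      let a , a∈ , e′ , eq = sees j (within k v∈) avoid u∈ (sym G e) (colour (f k) v) in
      a , v , a∈ , v∈ , sym G e′ , eq
      where
      avoid : AvoidsFrom (toℕ j) f v
      avoid i j≤i v∈i with disj v∈ v∈i
      ... | refl = ne (toℕ-injective (ℕ.≤-antisym j≤i k≤j))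

    -- The touching parts form a clique and, together with C, an odd minor.
    few-touching : ∀ m {C} → Nonempty C → C ⊆ V G → Conn E C → (∀ {x} → x ∈ C → AvoidsFrom m f x) →
      (g : Fin (2 + t₀) → Fin ℓ) → (∀ {r s} → g r ≡ g s → r ≡ s) →
      ¬ (∀ s → m ≤ toℕ (g s) × Touches (set (f (g s))) C)
    few-touching m {C} (x , x∈C) C⊆ conn avoid g inj touch = noMinor
      (OddMinor.hasOddMinor G (set ∘ P) (colour ∘ P) P⊆ P-nonempty P-crosses P-disj P-link)
      where
      spanning = Good-spanning x∈C conn

      P : Fin (3 + t₀) → Part n
      P zero    = part C (proj₁ spanning)
      P (suc s) = f (g s)

      P⊆ : ∀ s → set (P s) ⊆ V G
      P⊆ zero    = C⊆
      P⊆ (suc s) = within (g s)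

      P-nonempty : ∀ s → Nonempty (set (P s))
      P-nonempty zero    = x , x∈C
      P-nonempty (suc s) = nonempty (g s)

      P-crosses : ∀ s → Conn (Cross (colour (P s))) (set (P s))
      P-crosses zero    = Good.crossing-conn (proj₂ spanning)
      P-crosses (suc s) = crosses (g s)

      P-disj : ∀ {r s x} → x ∈ set (P r) → x ∈ set (P s) → r ≡ s
      P-disj {zero}  {zero}  _  _  = refl
      P-disj {zero}  {suc s} x∈ y∈ = contradiction y∈ (avoid x∈ (g s) (proj₁ (touch s)))
      P-disj {suc r} {zero}  x∈ y∈ = contradiction x∈ (avoid y∈ (g r) (proj₁ (touch r)))
      P-disj {suc r} {suc s} x∈ y∈ = cong suc (inj (disj x∈ y∈))

      P-link₀ : ∀ s → Linked-parts (P (suc s)) (P zero)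
      P-link₀ s with touch s
      ... | m≤ , u , v , u∈ , v∈ , e =
        -- `v` lies in `C`, hence in no part from `m` on, so it sees both colours in `f (g s)`; the
        -- colour requested is its own.
        let a , a∈ , e′ , eq = sees (g s) (C⊆ v∈) (λ j gs≤j → avoid v∈ j (≤-trans m≤ gs≤j)) u∈ (sym G e)
                                 (proj₁ spanning v) in
        a , v , a∈ , v∈ , sym G e′ , eq

      P-link : ∀ r s → r ≢ s → Linked-parts (P r) (P s)
      P-link zero    zero    ne = contradiction refl ne
      P-link zero    (suc s) _  = Linked-sym {P (suc s)} {P zero} (P-link₀ s)
      P-link (suc r) zero    _  = P-link₀ r
      P-link (suc r) (suc s) ne =
        touching-parts-linked gr≢gs
          (clique m C⊆ conn avoid (proj₁ (touch r)) (proj₁ (touch s)) gr≢gs (proj₂ (touch r)) (proj₂ (touch s)))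
        where
        gr≢gs : g r ≢ g s
        gr≢gs eq = ne (cong suc (inj eq))

    private
      free? : U.Decidable (λ x → x ∈ V G × AvoidsFrom 0 f x)
      free? x = (x ∈? V G) ×-dec all? λ j → Dec.map′ (λ x∉ _ → x∉) (λ avoid → avoid z≤n) (¬? (x ∈? set (f j)))

    free : Subset n
    free = select free?

    ∈-free⁺ : ∀ {x} → x ∈ V G → AvoidsFrom 0 f x → x ∈ free
    ∈-free⁺ x∈ avoid = ∈-select⁺ free? (x∈ , avoid)

    ∈-free⁻ : ∀ {x} → x ∈ free → x ∈ V G × AvoidsFrom 0 f x
    ∈-free⁻ = ∈-select⁻ free?

    module Extend {v : Fin n} (v∈free : v ∈ free) where

      private
        comp = component (adj? G) free v∈free (sym G)
        C = proj₁ comp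
        C-conn = proj₁ (proj₂ comp)
        v∈C = proj₁ (proj₂ (proj₂ comp))

        C⊆free : C ⊆ free
        C⊆free = proj₁ (proj₂ (proj₂ (proj₂ comp)))

        C-closed : ∀ {a b} → a ∈ C → b ∈ free → E a b → b ∈ C
        C-closed = proj₂ (proj₂ (proj₂ (proj₂ comp)))

        C⊆V : C ⊆ V G
        C⊆V x∈ = proj₁ (∈-free⁻ (C⊆free x∈))

        touching? : U.Decidable (λ j → Touches C (set (f j)))
        touching? j = touches? C (set (f j))

        J : Subset ℓ
        J = select touching?

        ∣J∣≤ : ∣ J ∣ ≤ suc t₀
        ∣J∣≤ = decidable-stable (∣ J ∣ ≤? suc t₀) λ ≰ →
          -- One part too many would give `2 + t₀` parts touching `C`, which `few-touching`
          -- excludes.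
          let g , inj , g∈ = injection-into J (2 + t₀) (ℕ.≰⇒> ≰) in
          few-touching 0 (v , v∈C) C⊆V C-conn (λ x∈ → proj₂ (∈-free⁻ (C⊆free x∈))) g inj
            λ s → z≤n , Touches-sym (∈-select⁻ touching? (g∈ s))

        Terminals : Set
        Terminals = ∃[ S ] ∃[ r ] r ∈ S × S ⊆ C × ∣ S ∣ ≤ suc t₀ ×
          (∀ {j} → Touches C (set (f j)) → Touches S (set (f j)))

        terminals : Terminals
        terminals with representatives J {P = λ j x → ∃[ w ] w ∈ set (f j) × E x w}
          (λ j∈ → let u , w , u∈ , w∈ , e = ∈-select⁻ touching? j∈ in u , u∈ , w , w∈ , e)
        ... | S , S⊆ , size , rep with nonempty? S
        ... | yes (r , r∈) = S , r , r∈ , S⊆ , ≤-trans size ∣J∣≤ , λ tch →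
          let x , x∈ , w , w∈ , e = rep (∈-select⁺ touching? tch) in x , w , x∈ , w∈ , e
        -- No part touches `C`, as for the first part of all; then `v` serves as the only terminal,
        -- since a root is required.
        ... | no ¬r = ⁅ v ⁆ , v , x∈⁅x⁆ v , ⁅x⁆⊆ v∈C , ≤-trans (≤-reflexive (∣⁅x⁆∣≡1 v)) (s≤s z≤n) , λ tch →
          let x , x∈ , _ = rep (∈-select⁺ touching? tch) in contradiction (x , x∈) ¬r

        S = proj₁ terminals

        r∈S : proj₁ (proj₂ terminals) ∈ S
        r∈S = proj₁ (proj₂ (proj₂ terminals))

        S⊆C : S ⊆ C
        S⊆C = proj₁ (proj₂ (proj₂ (proj₂ terminals)))

        ∣S∣≤ : ∣ S ∣ ≤ suc t₀
        ∣S∣≤ = proj₁ (proj₂ (proj₂ (proj₂ (proj₂ terminals))))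

        S-touches : ∀ {j} → Touches C (set (f j)) → Touches S (set (f j))
        S-touches = proj₂ (proj₂ (proj₂ (proj₂ (proj₂ terminals))))

        steiner = Good-steiner C-conn S⊆C r∈S
        X = proj₁ steiner

        X⊆C : X ⊆ C
        X⊆C = proj₁ (proj₂ steiner)

        S⊆X : S ⊆ X
        S⊆X = proj₁ (proj₂ (proj₂ steiner))

        good = proj₂ (proj₂ (proj₂ (proj₂ steiner)))

        -- The doubled size is at most `suc ∣ S ∣ ≤ 2 + t₀`, and half of this rounded down is
        -- `⌈ suc t₀ /2⌉`.
        X-small : ∀ {D} → D ⊆ X → Conn (Mono (proj₁ (proj₂ (proj₂ (proj₂ steiner))))) D → ∣ D ∣ ≤ ⌈ suc t₀ /2⌉
        X-small {D} D⊆ conn = ≤-trans (≤-reflexive (ℕ.n≡⌊n+n/2⌋ ∣ D ∣))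
          (ℕ.⌊n/2⌋-mono (≤-trans (Good.clusters good D⊆ conn) (s≤s ∣S∣≤)))

        sat = saturate X⊆C (_ , S⊆X r∈S) (Good.crossing-conn good) (s≤s z≤n) X-small
        Y = proj₁ sat

        X⊆Y : X ⊆ Y
        X⊆Y = proj₁ (proj₂ sat)

        Y⊆C : Y ⊆ C
        Y⊆C = proj₁ (proj₂ (proj₂ sat))

        Y-avoids : ∀ {x} → x ∈ Y → AvoidsFrom 0 f x
        Y-avoids x∈ = proj₂ (∈-free⁻ (C⊆free (Y⊆C x∈)))

        colour-Y = proj₁ (proj₂ (proj₂ (proj₂ sat)))
        Y-props = proj₂ (proj₂ (proj₂ (proj₂ sat)))

      new : Part n
      new = part Y colour-Y

      new-nonempty : ∃[ x ] x ∈ set new × x ∈ free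
      new-nonempty = _ , X⊆Y (S⊆X r∈S) , C⊆free (Y⊆C (X⊆Y (S⊆X r∈S)))

      private
        -- A connected set `D` of remaining vertices that touches `Y` lies in the component `C`. A
        -- part touching `D` thus touches `C`, so it is adjacent to a terminal, and all terminals
        -- are in `Y`.
        new-touches : ∀ {D} → D ⊆ V G → Conn E D → (∀ {x} → x ∈ D → AvoidsFrom 0 (new ∷ᶠ f) x) →
          ∀ {j} → Touches Y D → Touches (set (f j)) D → Touches Y (set (f j))
        new-touches {D} D⊆ conn avoid (_ , x , y∈ , x∈ , e) (u , w , u∈ , w∈ , e′) =
          let s , z , s∈ , z∈ , e″ = S-touches (w , u , D⊆C w∈ , u∈ , sym G e′) in
          s , z , X⊆Y (S⊆X s∈) , z∈ , e″
          where
          D⊆free : D ⊆ free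
          D⊆free a∈ = ∈-free⁺ (D⊆ a∈) λ j _ → avoid a∈ (suc j) z≤n
          D⊆C : D ⊆ C
          D⊆C a∈ = closed-star {P = _∈ C} (λ _ b∈ e a∈C → C-closed a∈C (D⊆free b∈) e)
            (conn x∈ a∈) (C-closed (Y⊆C y∈) (D⊆free x∈) e)

        new-disj : ∀ {j k x} → x ∈ set ((new ∷ᶠ f) j) → x ∈ set ((new ∷ᶠ f) k) → j ≡ k
        new-disj {zero}  {zero}  _  _  = refl
        new-disj {zero}  {suc k} x∈ y∈ = contradiction y∈ (Y-avoids x∈ k z≤n)
        new-disj {suc j} {zero}  x∈ y∈ = contradiction x∈ (Y-avoids y∈ j z≤n)
        new-disj {suc j} {suc k} x∈ y∈ = cong suc (disj x∈ y∈)

      chain-extend : Chain (new ∷ᶠ f)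
      chain-extend = record
        { within   = λ { zero → λ x∈ → C⊆V (Y⊆C x∈) ; (suc k) → within k }
        ; nonempty = λ { zero → _ , proj₁ (proj₂ new-nonempty) ; (suc k) → nonempty k }
        ; crosses  = λ { zero → proj₁ Y-props ; (suc k) → crosses k }
        ; small    = λ { zero → proj₁ (proj₂ Y-props) ; (suc k) → small k }
        ; disj     = new-disj
        ; sees     = λ where
            -- `v` is free and adjacent to a vertex of `C`, so it lies in `C`, where saturation
            -- applies.
            zero v∈ avoid u∈ e → proj₂ (proj₂ Y-props)
              (C-closed (Y⊆C u∈) (∈-free⁺ v∈ λ j _ → avoid (suc j) z≤n) (sym G e)) (avoid zero z≤n) u∈ e
            (suc k) v∈ avoid u∈ e → sees k v∈ (λ j k≤j → avoid (suc j) (s≤s k≤j)) u∈ e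
        ; clique   = λ where
            zero D⊆ conn avoid {zero}  {zero}  _ _ ne _ _   → contradiction refl ne
            zero D⊆ conn avoid {zero}  {suc k} _ _ _ tY tk  → new-touches D⊆ conn avoid tY tk
            zero D⊆ conn avoid {suc j} {zero}  _ _ _ tj tY  → Touches-sym (new-touches D⊆ conn avoid tY tj)
            zero D⊆ conn avoid {suc j} {suc k} _ _ ne tj tk →
              clique 0 D⊆ conn (λ x∈ i _ → avoid x∈ (suc i) z≤n) z≤n z≤n (ne ∘ cong suc) tj tk
            (suc m) D⊆ conn avoid {suc j} {suc k} (s≤s m≤j) (s≤s m≤k) ne tj tk →
              clique m D⊆ conn (λ x∈ i m≤i → avoid x∈ (suc i) (s≤s m≤i)) m≤j m≤k (ne ∘ cong suc) tj tk
        }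

  -- Each new part contains a free vertex, so the number of free vertices drops until every vertex
  -- is covered.
  complete : ∀ m {ℓ} {f : Fin ℓ → Part n} (chain : Chain f) → ∣ free chain ∣ < m →
    Σ[ ℓ ∈ ℕ ] Σ[ f ∈ (Fin ℓ → Part n) ] Chain f × (∀ {x} → x ∈ V G → ∃[ j ] x ∈ set (f j))
  complete (suc m) {ℓ} {f} chain (s≤s free≤m) with nonempty? (free chain)
  ... | no empty = ℓ , f , chain , λ {x} x∈ →
    decidable-stable (any? λ j → x ∈? set (f j)) λ ¬x∈ →
      empty (x , ∈-free⁺ chain x∈ λ j _ x∈j → ¬x∈ (j , x∈j))
  ... | yes (v , v∈) = complete m chain-extend (≤-trans (p⊂q⇒∣p∣<∣q∣ shrinks) free≤m)
    where
    open Extend chain v∈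
    shrinks : free chain-extend ⊂ free chain
    shrinks = (λ x∈ → let x∈V , avoid = ∈-free⁻ chain-extend x∈ in
        ∈-free⁺ chain x∈V λ j _ → avoid (suc j) z≤n) ,
      let x , x∈new , x∈free = new-nonempty in
      x , x∈free , λ x∈ → proj₂ (∈-free⁻ chain-extend x∈) zero z≤n x∈new

  empty-chain : Chain {0} λ ()
  empty-chain = record
    { within   = λ ()
    ; nonempty = λ ()
    ; crosses  = λ ()
    ; small    = λ ()
    ; disj     = λ { {()} }
    ; sees     = λ ()
    ; clique   = λ { _ _ _ _ {()} }
    }

  decomposition : Σ[ ℓ ∈ ℕ ] Σ[ f ∈ (Fin ℓ → Part n) ] Chain f × (∀ {x} → x ∈ V G → ∃[ j ] x ∈ set (f j))
  decomposition = complete _ empty-chain ≤-refl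

-- Translation of a complete chain into the required subgraphs.

module FromChain (G : Graph n) (t₀ : ℕ) (noMinor : ¬ HasOddMinor (3 + t₀) G)
  {ℓ : ℕ} {f : Fin ℓ → Part n} (chain : Decomposition.Chain G t₀ noMinor f)
  (covers : ∀ {x} → x ∈ V G → ∃[ j ] x ∈ set (f j)) where

  open Colouring G
  open Decomposition G t₀ noMinor
  open Chain chain

  -- The chain lists the last part first; `opposite` restores the order of removal.
  W : Fin ℓ → Subset n
  W i = set (f (opposite i))

  H : Fin ℓ → Graph n
  H i = G [ W i ]

  ∈-H⁺ : ∀ i {x} → x ∈ W i → x ∈ V (H i)
  ∈-H⁺ i x∈ = x∈p∩q⁺ (within (opposite i) x∈ , x∈)

  ∈-H⁻ : ∀ i {x} → x ∈ V (H i) → x ∈ W i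
  ∈-H⁻ i = p∩q⊆q (V G) (W i)

  H-induced : ∀ i → H i ⊆ⁱ G
  H-induced i = (p∩q⊆p (V G) (W i) , proj₁) , λ u∈ v∈ e → e , ∈-H⁻ i u∈ , ∈-H⁻ i v∈

  H-connected : ∀ i → Connected (H i)
  H-connected i = (_ , ∈-H⁺ i (proj₂ (nonempty (opposite i)))) , λ u∈ v∈ →
    Conn-map (λ _ _ → proj₁) (crosses (opposite i)) (∈-H⁻ i u∈) (∈-H⁻ i v∈)

  H-disjoint : ∀ i j → i ≢ j → Disjoint (V (H i)) (V (H j))
  H-disjoint i j i≢j (x , x∈) =
    let x∈i , x∈j = x∈p∩q⁻ (V (H i)) (V (H j)) x∈ in
    i≢j (opposite-injective (disj (∈-H⁻ i x∈i) (∈-H⁻ j x∈j)))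

  H-covers : ⋃ (tabulate (V ∘ H)) ≡ V G
  H-covers = ⊆-antisym
    (λ x∈ → let i , x∈i = ∈-⋃⁻ (V ∘ H) x∈ in p∩q⊆p (V G) (W i) x∈i)
    λ x∈ → let j , x∈j = covers x∈ in
      ∈-⋃⁺ (V ∘ H) {opposite j} (∈-H⁺ (opposite j) (subst (λ k → _ ∈ set (f k)) (≡.sym (opposite-involutive j)) x∈j))

  module _ (i : Fin ℓ) where

    private
      k = opposite i
      c = colour (f k)

    class? : ∀ β → U.Decidable (λ x → x ∈ W i × c x ≡ β)
    class? β x = (x ∈? W i) ×-dec (c x Bool.≟ β)

    class : Bool → Subset n
    class β = select (class? β)

    classes-cover : class true ∪ class false ≡ V (H i)
    classes-cover = ⊆-antisym
      (λ x∈ → ∈-H⁺ i ([ proj₁ ∘ ∈-select⁻ (class? true) , proj₁ ∘ ∈-select⁻ (class? false) ]′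
        (x∈p∪q⁻ (class true) (class false) x∈)))
      λ {x} x∈ → x∈p∪q⁺ (split x∈ (c x) refl)
      where
      split : ∀ {x} → x ∈ V (H i) → ∀ β → c x ≡ β → x ∈ class true ⊎ x ∈ class false
      split x∈ true  eq = inj₁ (∈-select⁺ (class? true) (∈-H⁻ i x∈ , eq))
      split x∈ false eq = inj₂ (∈-select⁺ (class? false) (∈-H⁻ i x∈ , eq))

    classes-disjoint : Disjoint (class true) (class false)
    classes-disjoint (x , x∈) with x∈p∩q⁻ (class true) (class false) x∈
    ... | x∈t , x∈f = contradiction
      (trans (≡.sym (proj₂ (∈-select⁻ (class? true) x∈t))) (proj₂ (∈-select⁻ (class? false) x∈f))) λ ()

    -- All edges inside one colour class are monochromatic, so a component of the class is a cluster
    -- bounded by `small`.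
    class-component : ∀ β C → IsComponent (G [ class β ]) C → ∣ C ∣ ≤ ⌈ suc t₀ /2⌉
    class-component β C (C⊆ , (_ , conn) , _) = small k (proj₁ ∘ in-class) λ u∈ v∈ →
      Star.map (λ ((e , _) , a∈ , b∈) → (e , trans (proj₂ (in-class a∈)) (≡.sym (proj₂ (in-class b∈)))) , a∈ , b∈)
        (conn (x∈p∩q⁺ (C⊆ u∈ , u∈)) (x∈p∩q⁺ (C⊆ v∈ , v∈)))
      where
      in-class : ∀ {x} → x ∈ C → x ∈ W i × c x ≡ β
      in-class x∈ = ∈-select⁻ (class? β) (p∩q⊆q (V G) (class β) (C⊆ x∈))

    crossing-connected : Connected (crossing (H i) (class true) (class false))
    crossing-connected = proj₁ (H-connected i) , λ u∈ v∈ →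
      Star.map (λ ((e , neq) , a∈ , b∈) → (e , a∈ , b∈) , sides a∈ b∈ neq) (crosses k (∈-H⁻ i u∈) (∈-H⁻ i v∈))
      where
      sides : ∀ {a b} → a ∈ W i → b ∈ W i → c a ≢ c b →
        (a ∈ class true × b ∈ class false) ⊎ (a ∈ class false × b ∈ class true)
      sides {a} {b} a∈ b∈ neq with c a in ca | c b in cb
      ... | true  | true  = contradiction refl neq
      ... | false | false = contradiction refl neq
      ... | true  | false = inj₁ (∈-select⁺ (class? true) (a∈ , ca) , ∈-select⁺ (class? false) (b∈ , cb))
      ... | false | true  = inj₂ (∈-select⁺ (class? false) (a∈ , ca) , ∈-select⁺ (class? true) (b∈ , cb))

    -- Under `opposite` the chain indices from `k` onwards correspond to the subgraphs up to `i`,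
    -- with `i` itself included on both sides.
    ∉union⇒avoids : ∀ {v} → v ∈ V G ─ unionUpTo H i → AvoidsFrom (toℕ k) f v
    ∉union⇒avoids {v} v∈ j k≤j v∈j = proj₂ (x∈p─q⁻ v∈)
      (∈-unionUpTo H {i} {opposite j}
        (subst (opposite j ≤ᶠ_) (opposite-involutive i) (opposite-anti-≤ {i = k} {j} k≤j))
        (∈-H⁺ (opposite j) (subst (λ m → v ∈ set (f m)) (≡.sym (opposite-involutive j)) v∈j)))

    sees-both : ∀ v → v ∈ V G ─ unionUpTo H i → (∃[ u ] u ∈ V (H i) × Adj G v u) →
      (∃[ a ] a ∈ class true × Adj G v a) × (∃[ b ] b ∈ class false × Adj G v b)
    sees-both v v∈ (u , u∈ , e) = nbr true , nbr false
      where
      nbr : ∀ β → ∃[ a ] a ∈ class β × Adj G v a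
      nbr β = let a , a∈ , e′ , eq = sees k (p─q⊆p _ _ v∈) (∉union⇒avoids v∈) (∈-H⁻ i u∈) e β in
        a , ∈-select⁺ (class? β) (a∈ , eq) , e′

    module _ {C : Subset n} (C-comp : IsComponent (G -ᴳ unionUpTo H i) C) where

      private
        C⊆rest : ∀ {x} → x ∈ C → x ∈ V G ─ unionUpTo H i
        C⊆rest x∈ = p∩q⊆q (V G) _ (proj₁ C-comp x∈)

        C⊆V : C ⊆ V G
        C⊆V x∈ = p∩q⊆p (V G) _ (proj₁ C-comp x∈)

        C-nonempty : Nonempty C
        C-nonempty = let x , x∈ = proj₁ (proj₁ (proj₂ C-comp)) in x , p∩q⊆q _ C x∈

        C-conn : Conn E C
        C-conn u∈ v∈ = Star.map (λ ((e , _) , a∈ , b∈) → e , a∈ , b∈)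
          (proj₂ (proj₁ (proj₂ C-comp)) (x∈p∩q⁺ (proj₁ C-comp u∈ , u∈)) (x∈p∩q⁺ (proj₁ C-comp v∈ , v∈)))

        touches : ∀ j → Adjacent G (H j) (G [ C ]) → Touches (W j) C
        touches j (u , v , u∈ , v∈ , e) = u , v , ∈-H⁻ j u∈ , p∩q⊆q (V G) C v∈ , e

        Near : Fin ℓ → Set
        Near j = j ≤ᶠ i × Adjacent G (H j) (G [ C ])

        near? : U.Decidable Near
        near? j = (toℕ j ≤? toℕ i) ×-dec any? λ u → any? λ v →
          (u ∈? V (H j)) ×-dec (v ∈? V (G [ C ])) ×-dec adj? G u v

      few-near : AtMost (suc t₀) Near
      few-near = select near? , (λ j → mk⇔ (∈-select⁻ near?) (∈-select⁺ near?)) ,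
        decidable-stable (∣ select near? ∣ ≤? suc t₀) λ ≰ →
          -- More than `suc t₀` near subgraphs would supply the parts that `few-touching` forbids at
          -- the stage given by `k`.
          let g , inj , g∈ = injection-into (select near?) (2 + t₀) (ℕ.≰⇒> ≰) in
          few-touching chain (toℕ k) C-nonempty C⊆V C-conn (∉union⇒avoids ∘ C⊆rest)
            (opposite ∘ g) (inj ∘ opposite-injective) λ s →
            let j≤i , adj = ∈-select⁻ near? (g∈ s) in opposite-anti-≤ j≤i , touches (g s) adj

      near-clique : ∀ j j′ → j ≤ᶠ i → j′ ≤ᶠ i → j ≢ j′ →
        Adjacent G (H j) (G [ C ]) → Adjacent G (H j′) (G [ C ]) → Adjacent G (H j) (H j′)
      near-clique j j′ j≤i j′≤i ne adj adj′ =
        let u , v , u∈ , v∈ , e = clique (toℕ k) C⊆V C-conn (∉union⇒avoids ∘ C⊆rest)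
              (opposite-anti-≤ j≤i) (opposite-anti-≤ j′≤i) (ne ∘ opposite-injective)
              (touches j adj) (touches j′ adj′) in
        u , v , ∈-H⁺ j u∈ , ∈-H⁺ j′ v∈ , e

theorem3 : (t : ℕ) → 3 ≤ t →
    (n : ℕ) (G : Graph n) → Connected G → ¬ HasOddMinor t G →
    Σ[ ℓ ∈ ℕ ] Σ[ H ∈ (Fin ℓ → Graph n) ]
      (∀ i → H i ⊆ⁱ G) ×
      (∀ i → Connected (H i)) ×
      (∀ i j → i ≢ j → Disjoint (V (H i)) (V (H j))) ×
      ⋃ (tabulate (V ∘ H)) ≡ V G ×
      (∀ (i : Fin ℓ) → Σ[ A ∈ Subset n ] Σ[ B ∈ Subset n ]
        -- (1)
        (A ∪ B ≡ V (H i) × Disjoint A B ×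
         (∀ C → IsComponent (G [ A ]) C → ∣ C ∣ ≤ ⌈ t ∸ 2 /2⌉) ×
         (∀ C → IsComponent (G [ B ]) C → ∣ C ∣ ≤ ⌈ t ∸ 2 /2⌉)) ×
        -- (2)
        Connected (crossing (H i) A B) ×
        -- (3)
        (∀ v → v ∈ V G ─ unionUpTo H i → (∃[ u ] u ∈ V (H i) × Adj G v u) →
          (∃[ a ] a ∈ A × Adj G v a) × (∃[ b ] b ∈ B × Adj G v b)) ×
        -- (4)
        (∀ C → IsComponent (G -ᴳ unionUpTo H i) C →
          AtMost (t ∸ 2) (λ j → j ≤ᶠ i × Adjacent G (H j) (G [ C ])) ×
          (∀ j k → j ≤ᶠ i → k ≤ᶠ i → j ≢ k →
            Adjacent G (H j) (G [ C ]) → Adjacent G (H k) (G [ C ]) →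
            Adjacent G (H j) (H k))))
theorem3 (suc (suc (suc t₀))) (s≤s (s≤s (s≤s z≤n))) n G _ noMinor
  with Decomposition.decomposition G t₀ noMinor
... | ℓ , f , chain , covers =
  ℓ , H , H-induced , H-connected , H-disjoint , H-covers , λ i →
    class i true , class i false ,
    (classes-cover i , classes-disjoint i , class-component i true , class-component i false) ,
    crossing-connected i ,
    sees-both i ,
    λ C comp → few-near i comp , near-clique i comp
  where open FromChain G t₀ noMinor chain covers
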